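{- Let $4\le d\le 14$ and let $f(z)=b(z)\prod_{i=0}^{\lfloor d/2\rfloor-1}(z^2+z+c_i)$ be a $CL$-polynomial of degree $d$. Let $\mathbf{v}=(v_1,\dots,v_{\lfloor d/2\rfloor})$, where $v_l$ is the $l$-th elementary symmetric polynomial in $c_0,\dots,c_{\lfloor d/2\rfloor-1}$, and let $\langle\cdot,\cdot\rangle$ be the standard scalar product. Then $f$ satisfies $(\diamondsuit)$ if and only if all the inequalities listed below for its degree $d$ hold; in particular, in that case $\mathbf{v}$ lies in the convex hull of the points listed for $d$. $d=4$: $\langle(0,1),\mathbf v\rangle\ge0$; $\langle(1,-2),\mathbf v\rangle+2\ge0$; $\langle(-2,3),\mathbf v\rangle+8\ge0$. Points: $(22,12)$, $(4,0)$, $(-2,0)$. $d=5$: $\langle(0,1),\mathbf v\rangle\ge0$; $\langle(2,-1),\mathbf v\rangle+4\ge0$; $\langle(-3,1),\mathbf v\rangle+54\ge0$. Points: $(58,120)$, $(18,0)$, $(-2,0)$. $d=6$: $\langle(0,0,1),\mathbf v\rangle\ge0$; $\langle(2,1,-3),\mathbf v\rangle+4\ge0$; $\langle(8,-8,15),\mathbf v\rangle+160\ge0$; $\langle(-6,3,-5),\mathbf v\rangle+96\ge0$. Points: $(127,822,360)$, $(52,72,0)$, $(7,-18,0)$, $(-8,12,0)$. $d=7$: $\langle(0,0,1),\mathbf v\rangle\ge0$; $\langle(12,6,-5),\mathbf v\rangle+24\ge0$; $\langle(28,-6,3),\mathbf v\rangle+296\ge0$; $\langle(-96,12,-5),\mathbf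 v\rangle+4128\ge0$. Points: $(244,3708,5040)$, $(118,600,0)$, $(34,-72,0)$, $(-8,12,0)$. $d=8$: $\langle(0,0,0,1),\mathbf v\rangle\ge0$; $\langle(4,2,1,-4),\mathbf v\rangle+8\ge0$; $\langle(36,0,-3,7),\mathbf v\rangle+288\ge0$; $\langle(36,-18,15,-28),\mathbf v\rangle+4824\ge0$; $\langle(-224,32,-20,35),\mathbf v\rangle+9344\ge0$. Points: $(428,13324,52272,20160)$, $(232,3132,2880,0)$, $(92,52,-480,0)$, $(8,-116,192,0)$, $(-20,108,-144,0)$. $d=9$: $\langle(0,0,0,1),\mathbf v\rangle\ge0$; $\langle(24,12,6,-7),\mathbf v\rangle+48\ge0$; $\langle(84,6,-3,2),\mathbf v\rangle+600\ge0$; $\langle(1188,-126,27,-14),\mathbf v\rangle+41256\ge0$; $\langle(-1620,90,-15,7),\mathbf v\rangle+137160\ge0$. Points: $(700,39708,341136,362880)$, $(412,11772,35280,0)$, $(196,1404,-3600,0)$, $(52,-468,720,0)$, $(-20,108,-144,0)$. $d=10$: $\langle(0,0,0,0,1),\mathbf v\rangle\ge0$; $\langle(8,4,2,1,-5),\mathbf v\rangle+16\ge0$; $\langle(1120,128,-8,-16,45),\mathbf v\rangle+7424\ge0$; $\langle(920,-26,-4,7,-15),\mathbf v\rangle+20632\ge0$; $\langle(272,-224,68,-56,105),\mathbf v\rangle+442624\ge0$; $\langle(-4520,260,-50,35,-63),\mathbf v\rangle+378320\ge0$. Points: $(1085,104008,1757196,5132880,1814400)$, $(680,36508,277056,201600,0)$,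 $(365,7528,-3924,-25200,0)$, $(140,-572,-3024,7200,0)$, $(5,-392,2556,-3600,0)$, $(-40,508,-2304,2880,0)$. $d=11$: $\langle(0,0,0,0,1),\mathbf v\rangle\ge0$; $\langle(16,8,4,2,-3),\mathbf v\rangle+32\ge0$; $\langle(5904,792,36,-42,35),\mathbf v\rangle+37728\ge0$; $\langle(4704,48,-24,8,-5),\mathbf v\rangle+85440\ge0$; $\langle(19216,-1192,124,-28,15),\mathbf v\rangle+1740512\ge0$; $\langle(-31968,936,-72,14,-7),\mathbf v\rangle+4692384\ge0$. Points: $(1610,244708,7272216,44339040,39916800)$, $(1060,97308,1494576,3265920,0)$, $(620,26908,84816,-282240,0)$, $(290,1828,-30024,50400,0)$, $(70,-1692,9576,-12960,0)$, $(-40,508,-2304,2880,0)$. $d=12$: $\langle(0,0,0,0,0,1),\mathbf v\rangle\ge0$; $\langle(16,8,4,2,1,-6),\mathbf v\rangle+32\ge0$; $\langle(3680,544,56,-8,-10,33),\mathbf v\rangle+22912\ge0$; $\langle(75120,2568,-228,-6,45,-110),\mathbf v\rangle+1192224\ge0$; $\langle(187520,-4352,32,64,-80,165),\mathbf v\rangle+9601024\ge0$; $\langle(-7680,-984,144,-42,35,-66),\mathbf v\rangle+9717408\ge0$; $\langle(-104672,3104,-248,56,-42,77),\mathbf v\rangle+15276416\ge0$. Points: $(2306,530368,25971144,302788656,723263040,239500800)$, $(1580,232708,6523056,34999200,21772800,0)$, $(986,78268,804024,-840384,-2177280,0)$, $(524,13588,-95952,-108576,483840,0)$, $(194,-2912,-2232,105264,-181440,0)$,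 $(-4,-932,15984,-80064,103680,0)$, $(-70,1708,-17544,72000,-86400,0)$. $d=13$: $\langle(0,0,0,0,0,1),\mathbf v\rangle\ge0$; $\langle(96,48,24,12,6,-11),\mathbf v\rangle+192\ge0$; $\langle(6256,968,124,2,-9,9),\mathbf v\rangle+38432\ge0$; $\langle(86160,4200,-60,-30,15,-11),\mathbf v\rangle+1260960\ge0$; $\langle(1583520,-3984,-1560,300,-90,55),\mathbf v\rangle+60906432\ge0$; $\langle(2849920,-117280,6880,-760,180,-99),\mathbf v\rangle+590783360\ge0$; $\langle(-1475936,25592,-1064,98,-21,11),\mathbf v\rangle+344354528\ge0$. Points: $(3206,1071868,81406344,1627117056,7827719040,6227020800)$, $(2270,508708,23753736,249815520,439084800,0)$, $(1490,196708,4275576,6979680,-32659200,0)$, $(866,50068,-22536,-2702304,5080320,0)$, $(398,148,-123000,847008,-1209600,0)$, $(86,-4532,61704,-287424,362880,0)$, $(-70,1708,-17544,72000,-86400,0)$. $d=14$: $\langle(0,0,0,0,0,0,1),\mathbf v\rangle\ge0$; $\langle(32,16,8,4,2,1,-7),\mathbf v\rangle+64\ge0$; $\langle(45696,7296,1056,96,-24,-24,91),\mathbf v\rangle+278016\ge0$; $\langle(573216,33888,744,-168,6,33,-91),\mathbf v\rangle+7911552\ge0$; $\langle(24080000,269440,-22240,1120,200,-440,1001),\mathbf v\rangle+771857920\ge0$; $\langle(30693600,-533520,9720,540,-450,495,-1001),\mathbf v\rangle+3152571840\ge0$; $\langle(-7032576,-169728,15936,-2112,624,-528,1001),\mathbf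 v\rangle+6989196288\ge0$; $\langle(-5559008,96992,-4088,392,-98,77,-143),\mathbf v\rangle+1292719232\ge0$. Points: $(4347,2046870,231190132,7475341368,67360465152,138619313280,43589145600)$, $(3164,1036588,76136688,1431621504,6044647680,3353011200,0)$, $(2163,445998,17610220,114649848,-163634400,-279417600,0)$, $(1344,142968,1436608,-15125616,-2062080,50803200,0)$, $(707,19390,-492228,1431288,6560352,-15240960,0)$, $(252,-8820,51952,524928,-4578048,6773760,0)$, $(-21,-1722,66148,-787656,3441600,-4233600,0)$, $(-112,4648,-89280,808848,-3110400,3628800,0)$.
   Context: A $CL$-polynomial of degree $d$ is a polynomial of the form $f(z)=b(z)\prod_{i=0}^{\lfloor d/2\rfloor-1}(z^2+z+c_i)$, where the $c_i$ are real numbers $\geq\frac14$ and, for a non-zero constant $a$, $b(z)=a$ if $d$ is even and $b(z)=a(2z+1)$ if $d$ is odd. For a polynomial $f$ of degree $d$, the $h^*$-polynomial is the polynomial $h^*(t)=\sum_{i=0}^d h^*_i t^i$ with $\sum_{k\ge 0} f(k)t^k=\frac{h^*(t)}{(1-t)^{d+1}}$; equivalently $f(z)=\sum_{i=0}^d h_i^*\binom{z+d-i}{d}$. Property $(\diamondsuit)$ means that the coefficients of the $h^*$-polynomial of $f$ are palindromic (that is, $h^*_i=h^*_{d-i}$ for all $0\le i\le d$) and non-negative.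
   Formalization: The direction "inequalities imply (♢)" is stated only for a > 0: for a < 0 it fails (e.g. d=4, c_0=c_1=1/4, a=-1 satisfies all inequalities but h*_0=f(0)<0); the other direction and the convex hull claim hold for all non-zero a. -}

module Defs where

open import Algebra.Bundles using (CommutativeRing)
open import Data.Fin.Base as Fin using (Fin; toℕ)
open import Data.Integer.Base using (ℤ; +_)
import Data.Integer.Literals as ℤ-Literals
open import Data.List.Base as List using (List; []; _∷_; _++_)
open import Data.List.Relation.Unary.All using (All)
open import Data.Nat.Base as ℕ using (ℕ; zero; suc; ⌊_/2⌋; parity; _∸_)
open import Data.Nat.Combinatorics using (_C_)
import Data.Nat.Properties as ℕ
open import Data.Parity.Base using (Parity; 0ℙ; 1ℙ)
open import Data.Product.Base using (_×_; _,_; ∃; Σ-syntax)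
open import Data.Rational.Base as ℚ using (ℚ; 0ℚ; 1ℚ; ½)
import Data.Rational.Properties as ℚ
open import Data.Rational.Solver using (module +-*-Solver)
open import Data.Unit.Base using (tt)
open import Data.Vec.Base as Vec using (Vec; []; _∷_)
open import Data.Vec.Functional as Vector using (Vector)
open import Level using (0ℓ)
open import Relation.Binary.PropositionalEquality using (_≡_; refl; sym; cong; subst; module ≡-Reasoning)

-- The real numbers are Cauchy sequences of rationals; equality (_≈ℝ_) is
-- that the difference is a null sequence.

Cauchy : (ℕ → ℚ) → Set
Cauchy s = ∀ ε → 0ℚ ℚ.< ε →
  ∃ λ N → ∀ m n → N ℕ.≤ m → N ℕ.≤ n → ℚ.∣ s m ℚ.- s n ∣ ℚ.< ε

record ℝ : Set where
  constructor mkℝ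
  field
    seq    : ℕ → ℚ
    cauchy : Cauchy seq

open ℝ public

infix 4 _≈ℝ_ _≤ℝ_ _<ℝ_

_≈ℝ_ : ℝ → ℝ → Set
x ≈ℝ y = ∀ ε → 0ℚ ℚ.< ε →
  ∃ λ N → ∀ n → N ℕ.≤ n → ℚ.∣ seq x n ℚ.- seq y n ∣ ℚ.< ε

_≤ℝ_ : ℝ → ℝ → Set
x ≤ℝ y = ∀ ε → 0ℚ ℚ.< ε →
  ∃ λ N → ∀ n → N ℕ.≤ n → seq x n ℚ.< seq y n ℚ.+ ε

_<ℝ_ : ℝ → ℝ → Set
x <ℝ y = Σ[ ε ∈ ℚ ] 0ℚ ℚ.< ε ×
  (∃ λ N → ∀ n → N ℕ.≤ n → seq x n ℚ.+ ε ℚ.< seq y n)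

module ℚ-Estimates where

  half-pos : ∀ {ε} → 0ℚ ℚ.< ε → 0ℚ ℚ.< ε ℚ.* ½
  half-pos {ε} ε>0 = subst (ℚ._< ε ℚ.* ½) (ℚ.*-zeroˡ ½) (ℚ.*-monoˡ-<-pos ½ ε>0)

  half+half : ∀ ε → ε ℚ.* ½ ℚ.+ ε ℚ.* ½ ≡ ε
  half+half ε = begin
    ε ℚ.* ½ ℚ.+ ε ℚ.* ½  ≡⟨ ℚ.*-distribˡ-+ ε ½ ½ ⟨
    ε ℚ.* 1ℚ             ≡⟨ ℚ.*-identityʳ ε ⟩
    ε                    ∎
    where open ≡-Reasoning

  ∣+∣< : ∀ {p q r ε} → p ≡ q ℚ.+ r → ℚ.∣ q ∣ ℚ.< ε ℚ.* ½ → ℚ.∣ r ∣ ℚ.< ε ℚ.* ½ →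
         ℚ.∣ p ∣ ℚ.< ε
  ∣+∣< {p} {q} {r} {ε} p≡q+r q< r< = begin-strict
    ℚ.∣ p ∣               ≡⟨ cong ℚ.∣_∣ p≡q+r ⟩
    ℚ.∣ q ℚ.+ r ∣         ≤⟨ ℚ.∣p+q∣≤∣p∣+∣q∣ q r ⟩
    ℚ.∣ q ∣ ℚ.+ ℚ.∣ r ∣   <⟨ ℚ.+-mono-< q< r< ⟩
    ε ℚ.* ½ ℚ.+ ε ℚ.* ½   ≡⟨ half+half ε ⟩
    ε                     ∎
    where open ℚ.≤-Reasoning

  ∣-∣-comm : ∀ p q → ℚ.∣ p ℚ.- q ∣ ≡ ℚ.∣ q ℚ.- p ∣
  ∣-∣-comm p q = begin
    ℚ.∣ p ℚ.- q ∣           ≡⟨ cong ℚ.∣_∣ (solve 2 (λ p q → p :- q := :- (q :- p)) refl p q) ⟩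
    ℚ.∣ ℚ.- (q ℚ.- p) ∣     ≡⟨ ℚ.∣-p∣≡∣p∣ (q ℚ.- p) ⟩
    ℚ.∣ q ℚ.- p ∣           ∎
    where
    open ≡-Reasoning
    open +-*-Solver

  Bounded : (ℕ → ℚ) → Set
  Bounded s = Σ[ B ∈ ℚ ] 0ℚ ℚ.< B × (∃ λ N → ∀ n → N ℕ.≤ n → ℚ.∣ s n ∣ ℚ.≤ B)

  bounded : ∀ {s} → Cauchy s → Bounded s
  bounded {s} s-cauchy with s-cauchy 1ℚ (ℚ.positive⁻¹ 1ℚ)
  ... | N , close = 1ℚ ℚ.+ ℚ.∣ s N ∣
                  , ℚ.+-mono-<-≤ (ℚ.positive⁻¹ 1ℚ) (ℚ.0≤∣p∣ (s N))
                  , N , bound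
    where
    open ℚ.≤-Reasoning
    open +-*-Solver
    bound : ∀ n → N ℕ.≤ n → ℚ.∣ s n ∣ ℚ.≤ 1ℚ ℚ.+ ℚ.∣ s N ∣
    bound n N≤n = begin
      ℚ.∣ s n ∣                            ≡⟨ cong ℚ.∣_∣ (solve 2 (λ p q → p := (p :- q) :+ q) refl (s n) (s N)) ⟩
      ℚ.∣ (s n ℚ.- s N) ℚ.+ s N ∣          ≤⟨ ℚ.∣p+q∣≤∣p∣+∣q∣ (s n ℚ.- s N) (s N) ⟩
      ℚ.∣ s n ℚ.- s N ∣ ℚ.+ ℚ.∣ s N ∣      ≤⟨ ℚ.+-monoˡ-≤ ℚ.∣ s N ∣ (ℚ.<⇒≤ (close n N N≤n ℕ.≤-refl)) ⟩
      1ℚ ℚ.+ ℚ.∣ s N ∣                     ∎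

  shrink : ∀ B ε → 0ℚ ℚ.< B → 0ℚ ℚ.< ε → Σ[ δ ∈ ℚ ] 0ℚ ℚ.< δ ×
    (∀ {p q} → ℚ.∣ p ∣ ℚ.≤ B → ℚ.∣ q ∣ ℚ.< δ → ℚ.∣ p ℚ.* q ∣ ℚ.< ε)
  shrink B ε B>0 ε>0 = δ , δ>0 , bound
    where
    open ℚ.≤-Reasoning
    instance
      B-pos : ℚ.Positive B
      B-pos = ℚ.positive B>0
      ε-pos : ℚ.Positive ε
      ε-pos = ℚ.positive ε>0
      B-nonZero : ℚ.NonZero B
      B-nonZero = ℚ.pos⇒nonZero B
      B⁻¹-pos : ℚ.Positive (ℚ.1/ B)
      B⁻¹-pos = ℚ.1/pos⇒pos B
    δ : ℚ
    δ = ℚ.1/ B ℚ.* ε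
    δ>0 : 0ℚ ℚ.< δ
    δ>0 = ℚ.positive⁻¹ δ {{ℚ.pos*pos⇒pos (ℚ.1/ B) ε}}
    bound : ∀ {p q} → ℚ.∣ p ∣ ℚ.≤ B → ℚ.∣ q ∣ ℚ.< δ → ℚ.∣ p ℚ.* q ∣ ℚ.< ε
    bound {p} {q} p≤B q<δ = begin-strict
      ℚ.∣ p ℚ.* q ∣           ≡⟨ ℚ.∣p*q∣≡∣p∣*∣q∣ p q ⟩
      ℚ.∣ p ∣ ℚ.* ℚ.∣ q ∣     ≤⟨ ℚ.*-monoʳ-≤-nonNeg ℚ.∣ q ∣ {{ℚ.∣-∣-nonNeg q}} p≤B ⟩
      B ℚ.* ℚ.∣ q ∣           <⟨ ℚ.*-monoʳ-<-pos B q<δ ⟩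
      B ℚ.* (ℚ.1/ B ℚ.* ε)    ≡⟨ ℚ.*-assoc B (ℚ.1/ B) ε ⟨
      B ℚ.* ℚ.1/ B ℚ.* ε      ≡⟨ cong (ℚ._* ε) (ℚ.*-inverseʳ B) ⟩
      1ℚ ℚ.* ε                ≡⟨ ℚ.*-identityˡ ε ⟩
      ε                       ∎

  ≤⊔₁ : ∀ {k m} n → m ℕ.⊔ n ℕ.≤ k → m ℕ.≤ k
  ≤⊔₁ n = ℕ.m⊔n≤o⇒m≤o _ n

  ≤⊔₂ : ∀ {k} m {n} → m ℕ.⊔ n ℕ.≤ k → n ℕ.≤ k
  ≤⊔₂ m = ℕ.m⊔n≤o⇒n≤o m _

  +-split : ∀ p q p′ q′ → (p ℚ.+ q) ℚ.- (p′ ℚ.+ q′) ≡ (p ℚ.- p′) ℚ.+ (q ℚ.- q′)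
  +-split = solve 4 (λ p q p′ q′ → (p :+ q) :- (p′ :+ q′) := (p :- p′) :+ (q :- q′)) refl
    where open +-*-Solver

  *-split : ∀ p q p′ q′ →
    (p ℚ.* q) ℚ.- (p′ ℚ.* q′) ≡ p ℚ.* (q ℚ.- q′) ℚ.+ q′ ℚ.* (p ℚ.- p′)
  *-split = solve 4 (λ p q p′ q′ → (p :* q) :- (p′ :* q′) := p :* (q :- q′) :+ q′ :* (p :- p′)) refl
    where open +-*-Solver

  neg-split : ∀ p q → ℚ.∣ ℚ.- p ℚ.- ℚ.- q ∣ ≡ ℚ.∣ p ℚ.- q ∣
  neg-split p q = begin
    ℚ.∣ ℚ.- p ℚ.- ℚ.- q ∣   ≡⟨ cong ℚ.∣_∣ (solve 2 (λ p q → :- p :- :- q := q :- p) refl p q) ⟩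
    ℚ.∣ q ℚ.- p ∣           ≡⟨ ∣-∣-comm q p ⟩
    ℚ.∣ p ℚ.- q ∣           ∎
    where
    open ≡-Reasoning
    open +-*-Solver

open ℚ-Estimates

infixl 6 _+ℝ_
infixl 7 _*ℝ_
infix  8 -ℝ_

fromℚ : ℚ → ℝ
fromℚ q = mkℝ (λ _ → q) λ ε ε>0 → 0 , λ _ _ _ _ →
  subst (ℚ._< ε) (sym (cong ℚ.∣_∣ (ℚ.+-inverseʳ q))) ε>0

_+ℝ_ : ℝ → ℝ → ℝ
x +ℝ y = mkℝ (λ n → seq x n ℚ.+ seq y n) λ ε ε>0 →
  let M , x-close = cauchy x (ε ℚ.* ½) (half-pos ε>0)
      N , y-close = cauchy y (ε ℚ.* ½) (half-pos ε>0)
  in M ℕ.⊔ N , λ m n m≥ n≥ →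
    ∣+∣< (+-split (seq x m) (seq y m) (seq x n) (seq y n))
      (x-close m n (≤⊔₁ N m≥) (≤⊔₁ N n≥))
      (y-close m n (≤⊔₂ M m≥) (≤⊔₂ M n≥))

-ℝ_ : ℝ → ℝ
-ℝ x = mkℝ (λ n → ℚ.- seq x n) λ ε ε>0 →
  let N , x-close = cauchy x ε ε>0
  in N , λ m n m≥ n≥ →
    subst (ℚ._< ε) (sym (neg-split (seq x m) (seq x n))) (x-close m n m≥ n≥)

_*ℝ_ : ℝ → ℝ → ℝ
x *ℝ y = mkℝ (λ n → seq x n ℚ.* seq y n) λ ε ε>0 →
  let A , A>0 , K , x≤A = bounded (cauchy x)
      B , B>0 , L , y≤B = bounded (cauchy y)
      α , α>0 , x-small = shrink A (ε ℚ.* ½) A>0 (half-pos ε>0)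
      β , β>0 , y-small = shrink B (ε ℚ.* ½) B>0 (half-pos ε>0)
      M , y-close = cauchy y α α>0
      N , x-close = cauchy x β β>0
  in (K ℕ.⊔ L) ℕ.⊔ (M ℕ.⊔ N) , λ m n m≥ n≥ →
    let mKL = ≤⊔₁ {m} {K ℕ.⊔ L} (M ℕ.⊔ N) m≥
        nKL = ≤⊔₁ {n} {K ℕ.⊔ L} (M ℕ.⊔ N) n≥
        mMN = ≤⊔₂ {m} (K ℕ.⊔ L) {M ℕ.⊔ N} m≥
        nMN = ≤⊔₂ {n} (K ℕ.⊔ L) {M ℕ.⊔ N} n≥
    in ∣+∣< (*-split (seq x m) (seq y m) (seq x n) (seq y n))
      (x-small {seq x m} {seq y m ℚ.- seq y n} (x≤A m (≤⊔₁ L mKL)) (y-close m n (≤⊔₁ N mMN) (≤⊔₁ N nMN)))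
      (y-small {seq y n} {seq x m ℚ.- seq x n} (y≤B n (≤⊔₂ K nKL)) (x-close m n (≤⊔₂ M mMN) (≤⊔₂ M nMN)))

module ≈ℝ-Properties where

  pointwise : ∀ x y → (∀ n → seq x n ≡ seq y n) → x ≈ℝ y
  pointwise x y x≡y ε ε>0 = 0 , λ n _ → subst (ℚ._< ε) (sym (vanishes n)) ε>0
    where
    open ≡-Reasoning
    vanishes : ∀ n → ℚ.∣ seq x n ℚ.- seq y n ∣ ≡ 0ℚ
    vanishes n = begin
      ℚ.∣ seq x n ℚ.- seq y n ∣  ≡⟨ cong (λ q → ℚ.∣ q ℚ.- seq y n ∣) (x≡y n) ⟩
      ℚ.∣ seq y n ℚ.- seq y n ∣  ≡⟨ cong ℚ.∣_∣ (ℚ.+-inverseʳ (seq y n)) ⟩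
      0ℚ                         ∎

  ≈-sym : ∀ x y → x ≈ℝ y → y ≈ℝ x
  ≈-sym x y x≈y ε ε>0 = let N , close = x≈y ε ε>0 in N , λ n n≥ →
    subst (ℚ._< ε) (∣-∣-comm (seq x n) (seq y n)) (close n n≥)

  ≈-trans : ∀ x y z → x ≈ℝ y → y ≈ℝ z → x ≈ℝ z
  ≈-trans x y z x≈y y≈z ε ε>0 =
    let M , xy-close = x≈y (ε ℚ.* ½) (half-pos ε>0)
        N , yz-close = y≈z (ε ℚ.* ½) (half-pos ε>0)
    in M ℕ.⊔ N , λ n n≥ →
      ∣+∣< (solve 3 (λ p q r → p :- r := (p :- q) :+ (q :- r)) refl (seq x n) (seq y n) (seq z n))
        (xy-close n (≤⊔₁ N n≥)) (yz-close n (≤⊔₂ M n≥))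
    where open +-*-Solver

  +-cong : ∀ x x′ y y′ → x ≈ℝ x′ → y ≈ℝ y′ → x +ℝ y ≈ℝ x′ +ℝ y′
  +-cong x x′ y y′ x≈x′ y≈y′ ε ε>0 =
    let M , x-close = x≈x′ (ε ℚ.* ½) (half-pos ε>0)
        N , y-close = y≈y′ (ε ℚ.* ½) (half-pos ε>0)
    in M ℕ.⊔ N , λ n n≥ →
      ∣+∣< (+-split (seq x n) (seq y n) (seq x′ n) (seq y′ n))
        (x-close n (≤⊔₁ N n≥)) (y-close n (≤⊔₂ M n≥))

  -‿cong : ∀ x y → x ≈ℝ y → -ℝ x ≈ℝ -ℝ y
  -‿cong x y x≈y ε ε>0 = let N , close = x≈y ε ε>0 in N , λ n n≥ →
    subst (ℚ._< ε) (sym (neg-split (seq x n) (seq y n))) (close n n≥)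

  *-cong : ∀ x x′ y y′ → x ≈ℝ x′ → y ≈ℝ y′ → x *ℝ y ≈ℝ x′ *ℝ y′
  *-cong x x′ y y′ x≈x′ y≈y′ ε ε>0 =
    let A , A>0 , K , x≤A = bounded (cauchy x)
        B , B>0 , L , y′≤B = bounded (cauchy y′)
        α , α>0 , x-small = shrink A (ε ℚ.* ½) A>0 (half-pos ε>0)
        β , β>0 , y′-small = shrink B (ε ℚ.* ½) B>0 (half-pos ε>0)
        M , y-close = y≈y′ α α>0
        N , x-close = x≈x′ β β>0
    in (K ℕ.⊔ L) ℕ.⊔ (M ℕ.⊔ N) , λ n n≥ →
      let nKL = ≤⊔₁ {n} {K ℕ.⊔ L} (M ℕ.⊔ N) n≥
          nMN = ≤⊔₂ {n} (K ℕ.⊔ L) {M ℕ.⊔ N} n≥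
      in ∣+∣< (*-split (seq x n) (seq y n) (seq x′ n) (seq y′ n))
        (x-small {seq x n} {seq y n ℚ.- seq y′ n} (x≤A n (≤⊔₁ L nKL)) (y-close n (≤⊔₁ N nMN)))
        (y′-small {seq y′ n} {seq x n ℚ.- seq x′ n} (y′≤B n (≤⊔₂ K nKL)) (x-close n (≤⊔₂ M nMN)))

open ≈ℝ-Properties

fromℤ : ℤ → ℝ
fromℤ z = fromℚ (z ℚ./ 1)

fromℕ : ℕ → ℝ
fromℕ n = fromℤ (+ n)

0ℝ 1ℝ : ℝ
0ℝ = fromℚ 0ℚ
1ℝ = fromℚ 1ℚ

ℝ-commutativeRing : CommutativeRing 0ℓ 0ℓ
ℝ-commutativeRing = record
  { Carrier = ℝ ; _≈_ = _≈ℝ_ ; _+_ = _+ℝ_ ; _*_ = _*ℝ_ ; -_ = -ℝ_ ; 0# = 0ℝ ; 1# = 1ℝ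
  ; isCommutativeRing = record
    { isRing = record
      { +-isAbelianGroup = record
        { isGroup = record
          { isMonoid = record
            { isSemigroup = record
              { isMagma = record
                { isEquivalence = record
                  { refl = λ {x} → pointwise x x λ _ → refl
                  ; sym = λ {x} {y} → ≈-sym x y
                  ; trans = λ {x} {y} {z} → ≈-trans x y z
                  }
                ; ∙-cong = λ {x} {x′} {y} {y′} → +-cong x x′ y y′
                }
              ; assoc = λ x y z → pointwise (x +ℝ y +ℝ z) (x +ℝ (y +ℝ z))
                  λ n → ℚ.+-assoc (seq x n) (seq y n) (seq z n)
              }
            ; identity = (λ x → pointwise (0ℝ +ℝ x) x λ n → ℚ.+-identityˡ (seq x n))
                       , (λ x → pointwise (x +ℝ 0ℝ) x λ n → ℚ.+-identityʳ (seq x n))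
            }
          ; inverse = (λ x → pointwise (-ℝ x +ℝ x) 0ℝ λ n → ℚ.+-inverseˡ (seq x n))
                    , (λ x → pointwise (x +ℝ -ℝ x) 0ℝ λ n → ℚ.+-inverseʳ (seq x n))
          ; ⁻¹-cong = λ {x} {y} → -‿cong x y
          }
        ; comm = λ x y → pointwise (x +ℝ y) (y +ℝ x) λ n → ℚ.+-comm (seq x n) (seq y n)
        }
      ; *-cong = λ {x} {x′} {y} {y′} → *-cong x x′ y y′
      ; *-assoc = λ x y z → pointwise (x *ℝ y *ℝ z) (x *ℝ (y *ℝ z))
          λ n → ℚ.*-assoc (seq x n) (seq y n) (seq z n)
      ; *-identity = (λ x → pointwise (1ℝ *ℝ x) x λ n → ℚ.*-identityˡ (seq x n))
                   , (λ x → pointwise (x *ℝ 1ℝ) x λ n → ℚ.*-identityʳ (seq x n))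
      ; distrib = (λ x y z → pointwise (x *ℝ (y +ℝ z)) (x *ℝ y +ℝ x *ℝ z)
                      λ n → ℚ.*-distribˡ-+ (seq x n) (seq y n) (seq z n))
                , (λ x y z → pointwise ((y +ℝ z) *ℝ x) (y *ℝ x +ℝ z *ℝ x)
                      λ n → ℚ.*-distribʳ-+ (seq x n) (seq y n) (seq z n))
      }
    ; *-comm = λ x y → pointwise (x *ℝ y) (y *ℝ x) λ n → ℚ.*-comm (seq x n) (seq y n)
    }
  }

open import Algebra.Definitions.RawMonoid (CommutativeRing.+-rawMonoid ℝ-commutativeRing) public using (sum)
open import Algebra.Definitions.RawMonoid (CommutativeRing.*-rawMonoid ℝ-commutativeRing) public using () renaming (sum to product)

-- The factor b(z) of a CL-polynomial; the parity is that of the degree.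
leadingFactor : Parity → ℝ → ℝ → ℝ
leadingFactor 0ℙ a z = a
leadingFactor 1ℙ a z = a *ℝ (fromℕ 2 *ℝ z +ℝ 1ℝ)

-- The CL-polynomial is represented by its polynomial function on ℝ.
clPolynomial : (d : ℕ) → ℝ → Vector ℝ ⌊ d /2⌋ → ℝ → ℝ
clPolynomial d a c z =
  leadingFactor (parity d) a z *ℝ product (λ i → z *ℝ z +ℝ z +ℝ c i)

-- h lists the coefficients of the h*-polynomial of f (of degree d).  Since
-- 1/(1-t)^(d+1) = Σ_n C(n+d,d) t^n, comparing the coefficients of t^k in
-- Σ_k f(k) t^k = h*(t)/(1-t)^(d+1) gives f(k) = Σ_i h_i C(k+d-i,d), where
-- the terms with i > k vanish.
IsHStar : (d : ℕ) → (ℝ → ℝ) → Vector ℝ (suc d) → Set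
IsHStar d f h =
  ∀ k → f (fromℕ k) ≈ℝ sum (λ i → h i *ℝ fromℕ ((k ℕ.+ (d ∸ toℕ i)) C d))

Palindromic : ∀ {n} → Vector ℝ n → Set
Palindromic h = ∀ i → h i ≈ℝ h (Fin.opposite i)

NonNegative : ∀ {n} → Vector ℝ n → Set
NonNegative h = ∀ i → 0ℝ ≤ℝ h i

Diamond : (d : ℕ) → (ℝ → ℝ) → Set
Diamond d f = ∃ λ h → IsHStar d f h × Palindromic h × NonNegative h

-- The sublists of length l, one for each l-element set of positions.
combinations : ∀ {A : Set} → ℕ → List A → List (List A)
combinations zero    xs       = [] ∷ []
combinations (suc l) []       = []
combinations (suc l) (x ∷ xs) = List.map (x ∷_) (combinations l xs) ++ combinations (suc l) xs

elementarySymmetric : ∀ {n} → ℕ → Vector ℝ n → ℝ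
elementarySymmetric l c =
  List.foldr _+ℝ_ 0ℝ (List.map (List.foldr _*ℝ_ 1ℝ) (combinations l (Vector.toList c)))

-- The index i : Fin n stands for l = i + 1.
symmetricVector : ∀ {n} → Vector ℝ n → Vector ℝ n
symmetricVector c i = elementarySymmetric (suc (toℕ i)) c

fromℤⁿ : ∀ {n} → Vec ℤ n → Vector ℝ n
fromℤⁿ u i = fromℤ (Vec.lookup u i)

⟨_,_⟩ : ∀ {n} → Vector ℝ n → Vector ℝ n → ℝ
⟨ u , v ⟩ = sum λ i → u i *ℝ v i

Holds : ∀ {n} → Vector ℝ n → Vec ℤ n × ℤ → Set
Holds v (u , e) = 0ℝ ≤ℝ ⟨ fromℤⁿ u , v ⟩ +ℝ fromℤ e

InConvexHull : ∀ {n} → List (Vec ℤ n) → Vector ℝ n → Set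
InConvexHull {n} ps v = Σ[ w ∈ Vector ℝ (List.length ps) ]
  NonNegative w ×
  sum w ≈ℝ 1ℝ ×
  (∀ (j : Fin n) → v j ≈ℝ sum λ i → w i *ℝ fromℤⁿ (List.lookup ps i) j)

-- The lists of inequalities and points, for 4 ≤ d ≤ 14; the entry (u , e)
-- of inequalities d stands for ⟨u,v⟩ + e ≥ 0.  The remaining clauses are junk.

module _ where

  open import Agda.Builtin.FromNat using (fromNat)
  open import Agda.Builtin.FromNeg using (fromNeg)

  private instance
    ℤ-number = ℤ-Literals.number
    ℤ-negative = ℤ-Literals.negative

  inequalities : (d : ℕ) → List (Vec ℤ ⌊ d /2⌋ × ℤ)
  inequalities 4 =
    (0 ∷ 1 ∷ [] , 0) ∷
    (1 ∷ -2 ∷ [] , 2) ∷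
    (-2 ∷ 3 ∷ [] , 8) ∷
    []
  inequalities 5 =
    (0 ∷ 1 ∷ [] , 0) ∷
    (2 ∷ -1 ∷ [] , 4) ∷
    (-3 ∷ 1 ∷ [] , 54) ∷
    []
  inequalities 6 =
    (0 ∷ 0 ∷ 1 ∷ [] , 0) ∷
    (2 ∷ 1 ∷ -3 ∷ [] , 4) ∷
    (8 ∷ -8 ∷ 15 ∷ [] , 160) ∷
    (-6 ∷ 3 ∷ -5 ∷ [] , 96) ∷
    []
  inequalities 7 =
    (0 ∷ 0 ∷ 1 ∷ [] , 0) ∷
    (12 ∷ 6 ∷ -5 ∷ [] , 24) ∷
    (28 ∷ -6 ∷ 3 ∷ [] , 296) ∷
    (-96 ∷ 12 ∷ -5 ∷ [] , 4128) ∷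
    []
  inequalities 8 =
    (0 ∷ 0 ∷ 0 ∷ 1 ∷ [] , 0) ∷
    (4 ∷ 2 ∷ 1 ∷ -4 ∷ [] , 8) ∷
    (36 ∷ 0 ∷ -3 ∷ 7 ∷ [] , 288) ∷
    (36 ∷ -18 ∷ 15 ∷ -28 ∷ [] , 4824) ∷
    (-224 ∷ 32 ∷ -20 ∷ 35 ∷ [] , 9344) ∷
    []
  inequalities 9 =
    (0 ∷ 0 ∷ 0 ∷ 1 ∷ [] , 0) ∷
    (24 ∷ 12 ∷ 6 ∷ -7 ∷ [] , 48) ∷
    (84 ∷ 6 ∷ -3 ∷ 2 ∷ [] , 600) ∷
    (1188 ∷ -126 ∷ 27 ∷ -14 ∷ [] , 41256) ∷
    (-1620 ∷ 90 ∷ -15 ∷ 7 ∷ [] , 137160) ∷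
    []
  inequalities 10 =
    (0 ∷ 0 ∷ 0 ∷ 0 ∷ 1 ∷ [] , 0) ∷
    (8 ∷ 4 ∷ 2 ∷ 1 ∷ -5 ∷ [] , 16) ∷
    (1120 ∷ 128 ∷ -8 ∷ -16 ∷ 45 ∷ [] , 7424) ∷
    (920 ∷ -26 ∷ -4 ∷ 7 ∷ -15 ∷ [] , 20632) ∷
    (272 ∷ -224 ∷ 68 ∷ -56 ∷ 105 ∷ [] , 442624) ∷
    (-4520 ∷ 260 ∷ -50 ∷ 35 ∷ -63 ∷ [] , 378320) ∷
    []
  inequalities 11 =
    (0 ∷ 0 ∷ 0 ∷ 0 ∷ 1 ∷ [] , 0) ∷
    (16 ∷ 8 ∷ 4 ∷ 2 ∷ -3 ∷ [] , 32) ∷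
    (5904 ∷ 792 ∷ 36 ∷ -42 ∷ 35 ∷ [] , 37728) ∷
    (4704 ∷ 48 ∷ -24 ∷ 8 ∷ -5 ∷ [] , 85440) ∷
    (19216 ∷ -1192 ∷ 124 ∷ -28 ∷ 15 ∷ [] , 1740512) ∷
    (-31968 ∷ 936 ∷ -72 ∷ 14 ∷ -7 ∷ [] , 4692384) ∷
    []
  inequalities 12 =
    (0 ∷ 0 ∷ 0 ∷ 0 ∷ 0 ∷ 1 ∷ [] , 0) ∷
    (16 ∷ 8 ∷ 4 ∷ 2 ∷ 1 ∷ -6 ∷ [] , 32) ∷
    (3680 ∷ 544 ∷ 56 ∷ -8 ∷ -10 ∷ 33 ∷ [] , 22912) ∷
    (75120 ∷ 2568 ∷ -228 ∷ -6 ∷ 45 ∷ -110 ∷ [] , 1192224) ∷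
    (187520 ∷ -4352 ∷ 32 ∷ 64 ∷ -80 ∷ 165 ∷ [] , 9601024) ∷
    (-7680 ∷ -984 ∷ 144 ∷ -42 ∷ 35 ∷ -66 ∷ [] , 9717408) ∷
    (-104672 ∷ 3104 ∷ -248 ∷ 56 ∷ -42 ∷ 77 ∷ [] , 15276416) ∷
    []
  inequalities 13 =
    (0 ∷ 0 ∷ 0 ∷ 0 ∷ 0 ∷ 1 ∷ [] , 0) ∷
    (96 ∷ 48 ∷ 24 ∷ 12 ∷ 6 ∷ -11 ∷ [] , 192) ∷
    (6256 ∷ 968 ∷ 124 ∷ 2 ∷ -9 ∷ 9 ∷ [] , 38432) ∷
    (86160 ∷ 4200 ∷ -60 ∷ -30 ∷ 15 ∷ -11 ∷ [] , 1260960) ∷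
    (1583520 ∷ -3984 ∷ -1560 ∷ 300 ∷ -90 ∷ 55 ∷ [] , 60906432) ∷
    (2849920 ∷ -117280 ∷ 6880 ∷ -760 ∷ 180 ∷ -99 ∷ [] , 590783360) ∷
    (-1475936 ∷ 25592 ∷ -1064 ∷ 98 ∷ -21 ∷ 11 ∷ [] , 344354528) ∷
    []
  inequalities 14 =
    (0 ∷ 0 ∷ 0 ∷ 0 ∷ 0 ∷ 0 ∷ 1 ∷ [] , 0) ∷
    (32 ∷ 16 ∷ 8 ∷ 4 ∷ 2 ∷ 1 ∷ -7 ∷ [] , 64) ∷
    (45696 ∷ 7296 ∷ 1056 ∷ 96 ∷ -24 ∷ -24 ∷ 91 ∷ [] , 278016) ∷
    (573216 ∷ 33888 ∷ 744 ∷ -168 ∷ 6 ∷ 33 ∷ -91 ∷ [] , 7911552) ∷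
    (24080000 ∷ 269440 ∷ -22240 ∷ 1120 ∷ 200 ∷ -440 ∷ 1001 ∷ [] , 771857920) ∷
    (30693600 ∷ -533520 ∷ 9720 ∷ 540 ∷ -450 ∷ 495 ∷ -1001 ∷ [] , 3152571840) ∷
    (-7032576 ∷ -169728 ∷ 15936 ∷ -2112 ∷ 624 ∷ -528 ∷ 1001 ∷ [] , 6989196288) ∷
    (-5559008 ∷ 96992 ∷ -4088 ∷ 392 ∷ -98 ∷ 77 ∷ -143 ∷ [] , 1292719232) ∷
    []
  inequalities _ = []

  vertices : (d : ℕ) → List (Vec ℤ ⌊ d /2⌋)
  vertices 4 =
    (22 ∷ 12 ∷ []) ∷
    (4 ∷ 0 ∷ []) ∷
    (-2 ∷ 0 ∷ []) ∷
    []
  vertices 5 =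
    (58 ∷ 120 ∷ []) ∷
    (18 ∷ 0 ∷ []) ∷
    (-2 ∷ 0 ∷ []) ∷
    []
  vertices 6 =
    (127 ∷ 822 ∷ 360 ∷ []) ∷
    (52 ∷ 72 ∷ 0 ∷ []) ∷
    (7 ∷ -18 ∷ 0 ∷ []) ∷
    (-8 ∷ 12 ∷ 0 ∷ []) ∷
    []
  vertices 7 =
    (244 ∷ 3708 ∷ 5040 ∷ []) ∷
    (118 ∷ 600 ∷ 0 ∷ []) ∷
    (34 ∷ -72 ∷ 0 ∷ []) ∷
    (-8 ∷ 12 ∷ 0 ∷ []) ∷
    []
  vertices 8 =
    (428 ∷ 13324 ∷ 52272 ∷ 20160 ∷ []) ∷
    (232 ∷ 3132 ∷ 2880 ∷ 0 ∷ []) ∷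
    (92 ∷ 52 ∷ -480 ∷ 0 ∷ []) ∷
    (8 ∷ -116 ∷ 192 ∷ 0 ∷ []) ∷
    (-20 ∷ 108 ∷ -144 ∷ 0 ∷ []) ∷
    []
  vertices 9 =
    (700 ∷ 39708 ∷ 341136 ∷ 362880 ∷ []) ∷
    (412 ∷ 11772 ∷ 35280 ∷ 0 ∷ []) ∷
    (196 ∷ 1404 ∷ -3600 ∷ 0 ∷ []) ∷
    (52 ∷ -468 ∷ 720 ∷ 0 ∷ []) ∷
    (-20 ∷ 108 ∷ -144 ∷ 0 ∷ []) ∷
    []
  vertices 10 =
    (1085 ∷ 104008 ∷ 1757196 ∷ 5132880 ∷ 1814400 ∷ []) ∷
    (680 ∷ 36508 ∷ 277056 ∷ 201600 ∷ 0 ∷ []) ∷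
    (365 ∷ 7528 ∷ -3924 ∷ -25200 ∷ 0 ∷ []) ∷
    (140 ∷ -572 ∷ -3024 ∷ 7200 ∷ 0 ∷ []) ∷
    (5 ∷ -392 ∷ 2556 ∷ -3600 ∷ 0 ∷ []) ∷
    (-40 ∷ 508 ∷ -2304 ∷ 2880 ∷ 0 ∷ []) ∷
    []
  vertices 11 =
    (1610 ∷ 244708 ∷ 7272216 ∷ 44339040 ∷ 39916800 ∷ []) ∷
    (1060 ∷ 97308 ∷ 1494576 ∷ 3265920 ∷ 0 ∷ []) ∷
    (620 ∷ 26908 ∷ 84816 ∷ -282240 ∷ 0 ∷ []) ∷
    (290 ∷ 1828 ∷ -30024 ∷ 50400 ∷ 0 ∷ []) ∷
    (70 ∷ -1692 ∷ 9576 ∷ -12960 ∷ 0 ∷ []) ∷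
    (-40 ∷ 508 ∷ -2304 ∷ 2880 ∷ 0 ∷ []) ∷
    []
  vertices 12 =
    (2306 ∷ 530368 ∷ 25971144 ∷ 302788656 ∷ 723263040 ∷ 239500800 ∷ []) ∷
    (1580 ∷ 232708 ∷ 6523056 ∷ 34999200 ∷ 21772800 ∷ 0 ∷ []) ∷
    (986 ∷ 78268 ∷ 804024 ∷ -840384 ∷ -2177280 ∷ 0 ∷ []) ∷
    (524 ∷ 13588 ∷ -95952 ∷ -108576 ∷ 483840 ∷ 0 ∷ []) ∷
    (194 ∷ -2912 ∷ -2232 ∷ 105264 ∷ -181440 ∷ 0 ∷ []) ∷
    (-4 ∷ -932 ∷ 15984 ∷ -80064 ∷ 103680 ∷ 0 ∷ []) ∷
    (-70 ∷ 1708 ∷ -17544 ∷ 72000 ∷ -86400 ∷ 0 ∷ []) ∷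
    []
  vertices 13 =
    (3206 ∷ 1071868 ∷ 81406344 ∷ 1627117056 ∷ 7827719040 ∷ 6227020800 ∷ []) ∷
    (2270 ∷ 508708 ∷ 23753736 ∷ 249815520 ∷ 439084800 ∷ 0 ∷ []) ∷
    (1490 ∷ 196708 ∷ 4275576 ∷ 6979680 ∷ -32659200 ∷ 0 ∷ []) ∷
    (866 ∷ 50068 ∷ -22536 ∷ -2702304 ∷ 5080320 ∷ 0 ∷ []) ∷
    (398 ∷ 148 ∷ -123000 ∷ 847008 ∷ -1209600 ∷ 0 ∷ []) ∷
    (86 ∷ -4532 ∷ 61704 ∷ -287424 ∷ 362880 ∷ 0 ∷ []) ∷
    (-70 ∷ 1708 ∷ -17544 ∷ 72000 ∷ -86400 ∷ 0 ∷ []) ∷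
    []
  vertices 14 =
    (4347 ∷ 2046870 ∷ 231190132 ∷ 7475341368 ∷ 67360465152 ∷ 138619313280 ∷ 43589145600 ∷ []) ∷
    (3164 ∷ 1036588 ∷ 76136688 ∷ 1431621504 ∷ 6044647680 ∷ 3353011200 ∷ 0 ∷ []) ∷
    (2163 ∷ 445998 ∷ 17610220 ∷ 114649848 ∷ -163634400 ∷ -279417600 ∷ 0 ∷ []) ∷
    (1344 ∷ 142968 ∷ 1436608 ∷ -15125616 ∷ -2062080 ∷ 50803200 ∷ 0 ∷ []) ∷
    (707 ∷ 19390 ∷ -492228 ∷ 1431288 ∷ 6560352 ∷ -15240960 ∷ 0 ∷ []) ∷
    (252 ∷ -8820 ∷ 51952 ∷ 524928 ∷ -4578048 ∷ 6773760 ∷ 0 ∷ []) ∷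
    (-21 ∷ -1722 ∷ 66148 ∷ -787656 ∷ 3441600 ∷ -4233600 ∷ 0 ∷ []) ∷
    (-112 ∷ 4648 ∷ -89280 ∷ 808848 ∷ -3110400 ∷ 3628800 ∷ 0 ∷ []) ∷
    []
  vertices _ = []

Inequalities : (d : ℕ) → Vector ℝ ⌊ d /2⌋ → Set
Inequalities d v = All (Holds v) (inequalities d)

{-# OPTIONS --safe #-}

-- By Vieta, f = a b(z) Σ_l v_l (z² + z)^(⌊d/2⌋ - l) with v_0 = 1, so the h*-coefficients of f
-- are a times affine functions of v whose integer coefficients are the h*-coefficients of the
-- polynomials b(z) (z² + z)^j.  The listed inequalities are these affine functions up to positive
-- factors.  For each d this is a finite integer computation: two polynomials of degree at most d
-- that agree on 0, …, d agree on ℕ.  Conversely f determines its h*-coefficients, because the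
-- matrix C(k+d-i,d) is unitriangular, and a ≥ 0 follows from f(0) = a Π c_i ≥ 0.  Finally the
-- inequalities, scaled to have sum 1, are the barycentric coordinates for the listed points.
module Submission where

open import Defs
open import Algebra.Bundles using (CommutativeRing)
open import Data.Bool.Base using (if_then_else_)
open import Data.Fin.Base as Fin using (Fin; zero; suc; toℕ)
import Data.Fin.Properties as Fin
open import Data.Integer.Base as ℤ using (ℤ; +_; 0ℤ; 1ℤ)
import Data.Integer.Properties as ℤ
import Data.Integer.Tactic.RingSolver as ℤ-Solver
open import Data.List.Base as List using (List; []; _∷_; _++_; length)
import Data.List.Properties as List
open import Data.List.Relation.Unary.All using (All; []; _∷_)
open import Data.Nat.Base as ℕ using (ℕ; zero; suc; _≤_; _<_; ⌊_/2⌋; parity; _∸_; _⊓_; _!; s≤s; z≤n)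
open import Data.Nat.Combinatorics using (_C_; nCk+nC[k+1]≡[n+1]C[k+1]; nCn≡1; k>n⇒nCk≡0)
open import Data.Nat.Induction using (<-rec)
import Data.Nat.Properties as ℕ
open import Data.Parity.Base using (Parity; 0ℙ; 1ℙ)
open import Data.Product.Base using (_×_; _,_; ∃; proj₁; proj₂)
open import Data.Rational.Base as ℚ using (ℚ; 0ℚ; 1ℚ; ½; _/_)
import Data.Rational.Properties as ℚ
open import Data.Rational.Solver using (module +-*-Solver)
import Data.Rational.Unnormalised.Base as ℚᵘ
import Data.Rational.Unnormalised.Properties as ℚᵘ
open import Data.Sum.Base using (inj₁; inj₂)
open import Data.Unit.Base using (tt)
open import Data.Vec.Base as Vec using (Vec; []; _∷_)
open import Data.Vec.Functional as Vector using (Vector)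
open import Data.Vec.Properties using (lookup-replicate)
open import Function.Base using (_∘_)
open import Level using (0ℓ)
open import Relation.Binary.Definitions using (tri<; tri≈; tri>)
open import Relation.Binary.PropositionalEquality as ≡ using (_≡_; _≗_)
open import Relation.Nullary.Decidable using (Dec; yes; no; does; toWitness; _×-dec_; _→-dec_)
open import Relation.Nullary.Negation using (contradiction)
open import Relation.Nullary.Negation.Core using (¬_)

open import Algebra.Definitions.RawMonoid ℤ.+-0-rawMonoid using () renaming (sum to sumℤ)
open import Algebra.Definitions.RawMonoid ℚ.+-0-rawMonoid using () renaming (sum to sumℚ)
open import Algebra.Definitions.RawMonoid ℚ.*-1-rawMonoid using () renaming (sum to productℚ)
open import Algebra.Properties.Monoid.Sum ℚ.+-0-monoid using (sum-cong-≗)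

-- Functions ℕ → ℤ with vanishing iterated differences

Δ : (ℕ → ℤ) → ℕ → ℤ
Δ f k = f (suc k) ℤ.- f k

-- These are the integer-valued polynomials of degree less than `n`, described by their values
-- alone: each difference lowers the degree by one, and no coefficients have to be chosen.
DegreeBelow : ℕ → (ℕ → ℤ) → Set
DegreeBelow zero    f = ∀ k → f k ≡ 0ℤ
DegreeBelow (suc n) f = DegreeBelow n (Δ f)

degree-resp-≗ : ∀ n {f g} → f ≗ g → DegreeBelow n f → DegreeBelow n g
degree-resp-≗ zero    f≗g f-deg k = ≡.trans (≡.sym (f≗g k)) (f-deg k)
degree-resp-≗ (suc n) f≗g f-deg =
  degree-resp-≗ n (λ k → ≡.cong₂ ℤ._-_ (f≗g (suc k)) (f≗g k)) f-deg

degree-zero : ∀ n {f} → (∀ k → f k ≡ 0ℤ) → DegreeBelow n f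
degree-zero zero    f≡0 = f≡0
degree-zero (suc n) f≡0 = degree-zero n λ k → ≡.cong₂ ℤ._-_ (f≡0 (suc k)) (f≡0 k)

degree-+ : ∀ n {f g} → DegreeBelow n f → DegreeBelow n g → DegreeBelow n (λ k → f k ℤ.+ g k)
degree-+ zero    f-deg g-deg k = ≡.cong₂ ℤ._+_ (f-deg k) (g-deg k)
degree-+ (suc n) {f} {g} f-deg g-deg = degree-resp-≗ n
  (λ k → interchange (f (suc k)) (f k) (g (suc k)) (g k)) (degree-+ n f-deg g-deg)
  where
  interchange : ∀ a b c d → (a ℤ.- b) ℤ.+ (c ℤ.- d) ≡ (a ℤ.+ c) ℤ.- (b ℤ.+ d)
  interchange = ℤ-Solver.solve-∀

degree-scale : ∀ n c {f} → DegreeBelow n f → DegreeBelow n (λ k → c ℤ.* f k)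
degree-scale zero    c f-deg k = ≡.trans (≡.cong (c ℤ.*_) (f-deg k)) (ℤ.*-zeroʳ c)
degree-scale (suc n) c {f} f-deg = degree-resp-≗ n
  (λ k → distrib c (f (suc k)) (f k)) (degree-scale n c f-deg)
  where
  distrib : ∀ c a b → c ℤ.* (a ℤ.- b) ≡ c ℤ.* a ℤ.- c ℤ.* b
  distrib = ℤ-Solver.solve-∀

degree-sum : ∀ n {m} {f : Fin m → ℕ → ℤ} → (∀ i → DegreeBelow n (f i)) →
             DegreeBelow n (λ k → sumℤ λ i → f i k)
degree-sum n {zero}  f-deg = degree-zero n λ _ → ≡.refl
degree-sum n {suc m} f-deg = degree-+ n (f-deg zero) (degree-sum n (f-deg ∘ suc))

degree-suc : ∀ n {f} → DegreeBelow n f → DegreeBelow (suc n) f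
degree-suc zero    f-deg k = ≡.cong₂ ℤ._-_ (f-deg (suc k)) (f-deg k)
degree-suc (suc n) f-deg = degree-suc n f-deg

degree-shift : ∀ n {f} → DegreeBelow n f → DegreeBelow n (f ∘ suc)
degree-shift zero    f-deg = f-deg ∘ suc
degree-shift (suc n) f-deg = degree-shift n f-deg

-- Discrete Leibniz rule: the difference of k f(k) is k `Δ f` k + f(k + 1). Induction handles the
-- first summand, and a shift preserves the degree of the second.
degree-*k : ∀ n {f} → DegreeBelow n f → DegreeBelow (suc n) (λ k → + k ℤ.* f k)
degree-*k zero    f-deg = degree-zero 1 λ k →
  ≡.trans (≡.cong (+ k ℤ.*_) (f-deg k)) (ℤ.*-zeroʳ (+ k))
degree-*k (suc n) {f} f-deg = degree-resp-≗ (suc n)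
  (λ k → leibniz (+ k) (f (suc k)) (f k))
  (degree-+ (suc n) {λ k → + k ℤ.* Δ f k} {f ∘ suc} (degree-*k n f-deg) (degree-shift (suc n) {f} f-deg))
  where
  leibniz : ∀ k a b → k ℤ.* (a ℤ.- b) ℤ.+ a ≡ (1ℤ ℤ.+ k) ℤ.* a ℤ.- k ℤ.* b
  leibniz = ℤ-Solver.solve-∀

-- Pascal's rule: the difference lowers the bottom entry of the binomial coefficient by one, down to
-- the constant 1.
degree-binomial : ∀ d j → DegreeBelow (suc d) (λ k → + ((k ℕ.+ j) C d))
degree-binomial zero    j k = ≡.refl
degree-binomial (suc d) j = degree-resp-≗ (suc d) pascal (degree-binomial d j)
  where
  cancel : ∀ a b → a ≡ (a ℤ.+ b) ℤ.- b
  cancel = ℤ-Solver.solve-∀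
  pascal : (λ k → + ((k ℕ.+ j) C d)) ≗ Δ (λ k → + ((k ℕ.+ j) C suc d))
  pascal k = ≡.trans (cancel (+ ((k ℕ.+ j) C d)) (+ ((k ℕ.+ j) C suc d)))
    (≡.cong (λ n → + n ℤ.- + ((k ℕ.+ j) C suc d)) (nCk+nC[k+1]≡[n+1]C[k+1] (k ℕ.+ j) d))

-- Zeros at 0, ..., n give zeros of the difference at 0, ..., n - 1. By induction the difference is
-- zero everywhere, so `f` is constant with value `f 0`.
vanishes : ∀ n {f} → DegreeBelow n f → (∀ k → k < n → f k ≡ 0ℤ) → ∀ k → f k ≡ 0ℤ
vanishes zero    f-deg f-zeros = f-deg
vanishes (suc n) {f} f-deg f-zeros = constant
  where
  Δf≡0 : ∀ k → Δ f k ≡ 0ℤ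
  Δf≡0 = vanishes n f-deg λ k k<n →
    ≡.cong₂ ℤ._-_ (f-zeros (suc k) (s≤s k<n)) (f-zeros k (ℕ.m<n⇒m<1+n k<n))
  constant : ∀ k → f k ≡ 0ℤ
  constant zero    = f-zeros 0 (s≤s z≤n)
  constant (suc k) = ≡.trans (ℤ.i-j≡0⇒i≡j (f (suc k)) (f k) (Δf≡0 k)) (constant k)

agree : ∀ n {f g} → DegreeBelow n f → DegreeBelow n g →
        (∀ k → k < n → f k ≡ g k) → f ≗ g
agree n {f} {g} f-deg g-deg f≡g k = ℤ.i-j≡0⇒i≡j (f k) (g k)
  (≡.trans (to-difference k) (vanishes n difference-deg zeros k))
  where
  difference : ℕ → ℤ
  difference k = f k ℤ.+ ℤ.-1ℤ ℤ.* g k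
  to-difference : ∀ k → f k ℤ.- g k ≡ difference k
  to-difference k = ≡.cong (λ z → f k ℤ.+ z) (≡.sym (ℤ.-1*i≡-i (g k)))
  difference-deg : DegreeBelow n difference
  difference-deg = degree-+ n f-deg (degree-scale n ℤ.-1ℤ g-deg)
  zeros : ∀ k → k < n → difference k ≡ 0ℤ
  zeros k k<n = ≡.trans (≡.sym (to-difference k))
    (≡.trans (≡.cong (ℤ._- g k) (f≡g k k<n)) (ℤ.i≡j⇒i-j≡0 {g k} ≡.refl))

degree-mono : ∀ {m n f} → m ≤ n → DegreeBelow m f → DegreeBelow n f
degree-mono {n = n} {f} m≤n f-deg = go (ℕ.≤⇒≤′ m≤n)
  where
  go : ∀ {n} → _ ℕ.≤′ n → DegreeBelow n f
  go ℕ.≤′-refl           = f-deg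
  go (ℕ.≤′-step {n} m≤n) = degree-suc n (go m≤n)

-- A factor k² + k turns `g` into k (k g) + k g, so two uses of `degree-*k` raise the bound by 2.
degree-power : ∀ e → DegreeBelow (suc (e ℕ.+ e)) (λ k → (+ k ℤ.* + k ℤ.+ + k) ℤ.^ e)
degree-power zero    k = ≡.refl
degree-power (suc e) rewrite ℕ.+-suc e e = degree-resp-≗ n
  (λ k → expand (+ k) ((+ k ℤ.* + k ℤ.+ + k) ℤ.^ e))
  (degree-+ n {λ k → + k ℤ.* (+ k ℤ.* g k)} {λ k → + k ℤ.* g k}
    (degree-*k (suc (suc (e ℕ.+ e))) {λ k → + k ℤ.* g k} kg-deg)
    (degree-suc (suc (suc (e ℕ.+ e))) {λ k → + k ℤ.* g k} kg-deg))
  where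
  n = suc (suc (suc (e ℕ.+ e)))
  g : ℕ → ℤ
  g k = (+ k ℤ.* + k ℤ.+ + k) ℤ.^ e
  kg-deg : DegreeBelow (suc (suc (e ℕ.+ e))) (λ k → + k ℤ.* g k)
  kg-deg = degree-*k (suc (e ℕ.+ e)) {g} (degree-power e)
  expand : ∀ k g → k ℤ.* (k ℤ.* g) ℤ.+ k ℤ.* g ≡ (k ℤ.* k ℤ.+ k) ℤ.* g
  expand = ℤ-Solver.solve-∀

-- Identities in commutative rings

-- The constant comes first, as the coefficient of v_0 = 1, so that an affine function of `v`
-- becomes linear in `1 ∷ v`.
coefficients : ∀ {m} → Vec ℤ m × ℤ → Vector ℤ (suc m)
coefficients (u , e) = Vec.lookup (e ∷ u)

δ : ∀ {n} → Fin n → Fin n → ℤ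
δ i j = if does (i Fin.≟ j) then 1ℤ else 0ℤ

-- Two rings occur: ℝ for the uniqueness of the h*-coefficients, and ℚ for identities that hold at
-- each index of the Cauchy sequences.
module RingIdentities (R : CommutativeRing 0ℓ 0ℓ) where

  open CommutativeRing R hiding (zero)
  open import Algebra.Properties.Group +-group using (x∙y⁻¹≈ε⇒x≈y)
  open import Algebra.Properties.Semiring.Sum semiring renaming (sum to ∑)
  open import Algebra.Properties.Semiring.Exp semiring using (_^_; ^-congˡ)
  open import Algebra.Definitions.RawMonoid *-rawMonoid using () renaming (sum to ∏)
  open import Algebra.Properties.CommutativeSemigroup *-commutativeSemigroup using (x∙yz≈y∙xz; xy∙z≈xz∙y)
  open import Relation.Binary.Reasoning.Setoid setoid

  -- Elementary symmetric polynomials and Vieta's formula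

  sumOfProducts : List (List Carrier) → Carrier
  sumOfProducts = List.foldr _+_ 0# ∘ List.map (List.foldr _*_ 1#)

  esym : ℕ → List Carrier → Carrier
  esym l xs = sumOfProducts (combinations l xs)

  sumOfProducts-++ : ∀ xss yss →
    sumOfProducts (xss ++ yss) ≈ sumOfProducts xss + sumOfProducts yss
  sumOfProducts-++ []         yss = sym (+-identityˡ _)
  sumOfProducts-++ (xs ∷ xss) yss = trans (+-congˡ (sumOfProducts-++ xss yss)) (sym (+-assoc _ _ _))

  sumOfProducts-∷ : ∀ x xss → sumOfProducts (List.map (x ∷_) xss) ≈ x * sumOfProducts xss
  sumOfProducts-∷ x []         = sym (zeroʳ x)
  sumOfProducts-∷ x (xs ∷ xss) = trans (+-congˡ (sumOfProducts-∷ x xss)) (sym (distribˡ x _ _))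

  esym-∷ : ∀ l x xs → esym (suc l) (x ∷ xs) ≈ x * esym l xs + esym (suc l) xs
  esym-∷ l x xs = trans (sumOfProducts-++ (List.map (x ∷_) (combinations l xs)) _)
    (+-congʳ (sumOfProducts-∷ x (combinations l xs)))

  -- Supplies the zero coefficient that `evaluate-suc` asks for in the induction step of `vieta`.
  esym-length : ∀ l xs → length xs < l → esym l xs ≈ 0#
  esym-length (suc l) []       _         = refl
  esym-length (suc l) (x ∷ xs) (s≤s len) = begin
    esym (suc l) (x ∷ xs)            ≈⟨ esym-∷ l x xs ⟩
    x * esym l xs + esym (suc l) xs  ≈⟨ +-cong (*-congˡ (esym-length l xs len)) (esym-length (suc l) xs (ℕ.m<n⇒m<1+n len)) ⟩
    x * 0# + 0#                      ≈⟨ trans (+-identityʳ _) (zeroʳ x) ⟩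
    0#                               ∎

  -- Powers descend, so that multiplication by `y` replaces `m` by `suc m` and leaves the
  -- coefficients in place.
  evaluate : Carrier → ∀ m → (ℕ → Carrier) → Carrier
  evaluate y m g = ∑ {suc m} λ l → g (toℕ l) * y ^ (m ∸ toℕ l)

  evaluate-suc : ∀ y m g → g (suc m) ≈ 0# → y * evaluate y m g ≈ evaluate y (suc m) g
  evaluate-suc y zero g g₁≈0 = begin
    y * (g 0 * 1# + 0#)                  ≈⟨ *-congˡ (+-identityʳ _) ⟩
    y * (g 0 * 1#)                       ≈⟨ x∙yz≈y∙xz y (g 0) 1# ⟩
    g 0 * (y * 1#)                       ≈⟨ +-identityʳ _ ⟨
    g 0 * (y * 1#) + 0#                  ≈⟨ +-congˡ (trans (+-identityʳ _) (trans (*-congʳ g₁≈0) (zeroˡ 1#))) ⟨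
    g 0 * (y * 1#) + (g 1 * 1# + 0#)     ∎
  evaluate-suc y (suc m) g g≈0 = begin
    y * (g 0 * y ^ suc m + evaluate y m (g ∘ suc))
      ≈⟨ distribˡ y _ _ ⟩
    y * (g 0 * y ^ suc m) + y * evaluate y m (g ∘ suc)
      ≈⟨ +-cong (x∙yz≈y∙xz y (g 0) _) (evaluate-suc y m (g ∘ suc) g≈0) ⟩
    evaluate y (suc (suc m)) g
      ∎

  vieta : ∀ y {m} (c : Vector Carrier m) →
          ∏ (λ i → y + c i) ≈ evaluate y m (λ l → esym l (Vector.toList c))
  vieta y {zero}  c = sym (trans (+-identityʳ _) (trans (*-identityʳ _) (+-identityʳ _)))
  vieta y {suc m} c = begin
    (y + x) * ∏ (λ i → y + c (suc i))
      ≈⟨ *-congˡ (vieta y (c ∘ suc)) ⟩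
    (y + x) * evaluate y m e
      ≈⟨ distribʳ _ y x ⟩
    y * evaluate y m e + x * evaluate y m e
      -- The first product is extended by the zero coefficient `e (suc m)`. After its leading term
      -- is split off, both sums run over the same powers and combine by the recurrence `esym-∷`.
      ≈⟨ +-cong (evaluate-suc y m e (esym-length (suc m) xs too-long))
           (*-distribˡ-sum {suc m} x (λ l → e (toℕ l) * y ^ (m ∸ toℕ l))) ⟩
    (e 0 * y ^ suc m + evaluate y m (e ∘ suc)) + ∑ (λ (l : Fin (suc m)) → x * (e (toℕ l) * y ^ (m ∸ toℕ l)))
      ≈⟨ +-assoc _ _ _ ⟩
    e 0 * y ^ suc m + (evaluate y m (e ∘ suc) + ∑ (λ (l : Fin (suc m)) → x * (e (toℕ l) * y ^ (m ∸ toℕ l))))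
      ≈⟨ +-congˡ (∑-distrib-+ {suc m} (λ l → e (suc (toℕ l)) * y ^ (m ∸ toℕ l)) (λ l → x * (e (toℕ l) * y ^ (m ∸ toℕ l)))) ⟨
    e 0 * y ^ suc m + ∑ (λ (l : Fin (suc m)) → e (suc (toℕ l)) * y ^ (m ∸ toℕ l) + x * (e (toℕ l) * y ^ (m ∸ toℕ l)))
      ≈⟨ +-congˡ (sum-cong-≋ {suc m} λ l → collect (toℕ l) (y ^ (m ∸ toℕ l))) ⟩
    evaluate y (suc m) (λ l → esym l (x ∷ xs))
      ∎
    where
    x = c zero
    xs = Vector.toList (c ∘ suc)
    e : ℕ → Carrier
    e l = esym l xs
    too-long : length xs < suc m
    too-long = s≤s (ℕ.≤-reflexive (List.length-tabulate (c ∘ suc)))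
    collect : ∀ l p → e (suc l) * p + x * (e l * p) ≈ esym (suc l) (x ∷ xs) * p
    collect l p = begin
      e (suc l) * p + x * (e l * p)   ≈⟨ +-comm _ _ ⟩
      x * (e l * p) + e (suc l) * p   ≈⟨ +-congʳ (*-assoc x (e l) p) ⟨
      x * e l * p + e (suc l) * p     ≈⟨ distribʳ p _ _ ⟨
      (x * e l + e (suc l)) * p       ≈⟨ *-congʳ (esym-∷ l x xs) ⟨
      esym (suc l) (x ∷ xs) * p       ∎

  -- Unitriangular linear systems

  sum-single : ∀ {n} (t : Vector Carrier n) i → (∀ j → i ≡.≢ j → t j ≈ 0#) → ∑ t ≈ t i
  sum-single {suc n} t i others = begin
    ∑ t                          ≈⟨ sum-remove {i = i} t ⟩
    t i + ∑ (Vector.removeAt t i) ≈⟨ +-congˡ (sum-cong-≋ λ j → others (Fin.punchIn i j) (Fin.punchInᵢ≢i i j ∘ ≡.sym)) ⟩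
    t i + ∑ (λ (_ : Fin n) → 0#)  ≈⟨ +-congˡ (sum-replicate-zero n) ⟩
    t i + 0#                       ≈⟨ +-identityʳ (t i) ⟩
    t i                            ∎

  -- Forward substitution: in row `k` the entries right of the diagonal are zero, the unknowns left
  -- of it are zero by induction, and only `g k` remains.
  unitriangular-injective : ∀ {n} (M : Fin n → Fin n → Carrier) →
    (∀ k → M k k ≈ 1#) → (∀ k i → toℕ k < toℕ i → M k i ≈ 0#) →
    ∀ (g : Vector Carrier n) → (∀ k → ∑ (λ i → g i * M k i) ≈ 0#) → ∀ k → g k ≈ 0#
  unitriangular-injective M diagonal upper g kernel k =
    <-rec (λ r → ∀ k → toℕ k ≡ r → g k ≈ 0#) step (toℕ k) k ≡.refl
    where
    step : ∀ r → (∀ {s} → s < r → ∀ k → toℕ k ≡ s → g k ≈ 0#) → ∀ k → toℕ k ≡ r → g k ≈ 0#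
    step r below k k≡r = begin
      g k                      ≈⟨ *-identityʳ (g k) ⟨
      g k * 1#                 ≈⟨ *-congˡ (diagonal k) ⟨
      g k * M k k              ≈⟨ sum-single (λ i → g i * M k i) k others ⟨
      ∑ (λ i → g i * M k i)  ≈⟨ kernel k ⟩
      0#                       ∎
      where
      others : ∀ i → k ≡.≢ i → g i * M k i ≈ 0#
      others i k≢i with ℕ.<-cmp (toℕ k) (toℕ i)
      ... | tri< k<i _ _ = trans (*-congˡ (upper k i k<i)) (zeroʳ (g i))
      ... | tri≈ _ k≡i _ = contradiction (Fin.toℕ-injective k≡i) k≢i
      ... | tri> _ _ i<k = trans (*-congʳ (below (≡.subst (toℕ i <_) k≡r i<k) i ≡.refl)) (zeroˡ (M k i))

  unitriangular-unique : ∀ {n} (M : Fin n → Fin n → Carrier) →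
    (∀ k → M k k ≈ 1#) → (∀ k i → toℕ k < toℕ i → M k i ≈ 0#) →
    ∀ (g h : Vector Carrier n) → (∀ k → ∑ (λ i → g i * M k i) ≈ ∑ (λ i → h i * M k i)) → ∀ k → g k ≈ h k
  unitriangular-unique {n} M diagonal upper g h agrees k =
    x∙y⁻¹≈ε⇒x≈y (g k) (h k) (unitriangular-injective M diagonal upper (λ i → g i - h i) kernel k)
    where
    kernel : ∀ k → ∑ (λ i → (g i - h i) * M k i) ≈ 0#
    kernel k = begin
      ∑ (λ i → (g i - h i) * M k i)
        ≈⟨ sum-cong-≋ {n} (λ i → distribʳ (M k i) (g i) (- h i)) ⟩
      ∑ (λ i → g i * M k i + - h i * M k i)
        ≈⟨ ∑-distrib-+ {n} (λ i → g i * M k i) (λ i → - h i * M k i) ⟩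
      ∑ (λ i → g i * M k i) + ∑ (λ i → - h i * M k i)
        ≈⟨ +-congʳ (agrees k) ⟩
      ∑ (λ i → h i * M k i) + ∑ (λ i → - h i * M k i)
        ≈⟨ ∑-distrib-+ {n} (λ i → h i * M k i) (λ i → - h i * M k i) ⟨
      ∑ (λ i → h i * M k i + - h i * M k i)
        ≈⟨ sum-cong-≋ {n} (λ i → trans (sym (distribʳ (M k i) (h i) (- h i))) (trans (*-congʳ (-‿inverseʳ (h i))) (zeroˡ (M k i)))) ⟩
      ∑ (λ (_ : Fin n) → 0#)
        ≈⟨ sum-replicate-zero n ⟩
      0#
        ∎

  -- Integer linear forms evaluated in the ring

  module Integers (φ : ℤ → Carrier)
    (φ-0 : φ 0ℤ ≈ 0#) (φ-1 : φ 1ℤ ≈ 1#)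
    (φ-+ : ∀ x y → φ (x ℤ.+ y) ≈ φ x + φ y)
    (φ-* : ∀ x y → φ (x ℤ.* y) ≈ φ x * φ y) where

    φ-sum : ∀ {n} (t : Vector ℤ n) → φ (sumℤ t) ≈ ∑ (φ ∘ t)
    φ-sum {zero}  t = φ-0
    φ-sum {suc n} t = trans (φ-+ (t zero) _) (+-congˡ (φ-sum (t ∘ suc)))

    φ-^ : ∀ x n → φ (x ℤ.^ n) ≈ φ x ^ n
    φ-^ x zero    = φ-1
    φ-^ x (suc n) = trans (φ-* x _) (*-congˡ (φ-^ x n))

    combine : ∀ {m} → Vector ℤ m → Vector Carrier m → Carrier
    combine r E = ∑ λ l → φ (r l) * E l

    -- Exchanging the sums over `l` and `i` turns integer identities for the single coefficients
    -- into one identity for the value at `E`.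
    sum-combine : ∀ {m n} (s : Vector ℤ n) (r : Fin n → Vector ℤ m) (p : Vector ℤ n) (β : Vector ℤ m) →
      (∀ l → β l ≡ sumℤ λ i → s i ℤ.* r i l ℤ.* p i) →
      ∀ E → combine β E ≈ ∑ λ i → φ (s i) * combine (r i) E * φ (p i)
    sum-combine {m} {n} s r p β β≡ E = begin
      ∑ (λ l → φ (β l) * E l)
        ≈⟨ sum-cong-≋ {m} (λ l → trans (*-congʳ (trans (reflexive (≡.cong φ (β≡ l))) (φ-sum {n} _))) (*-distribʳ-sum {n} (E l) _)) ⟩
      ∑ (λ l → ∑ λ i → φ (s i ℤ.* r i l ℤ.* p i) * E l)
        ≈⟨ ∑-comm {m} {n} _ ⟩
      ∑ (λ i → ∑ λ l → φ (s i ℤ.* r i l ℤ.* p i) * E l)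
        ≈⟨ sum-cong-≋ {n} (λ i → sum-cong-≋ {m} λ l → regroup (s i) (r i l) (p i) (E l)) ⟩
      ∑ (λ i → ∑ λ l → φ (s i) * (φ (r i l) * E l) * φ (p i))
        ≈⟨ sum-cong-≋ {n} (λ i → sym (trans (*-congʳ (*-distribˡ-sum {m} (φ (s i)) _)) (*-distribʳ-sum {m} (φ (p i)) _))) ⟩
      ∑ (λ i → φ (s i) * combine (r i) E * φ (p i))
        ∎
      where
      regroup : ∀ s r p e → φ (s ℤ.* r ℤ.* p) * e ≈ φ s * (φ r * e) * φ p
      regroup s r p e = begin
        φ (s ℤ.* r ℤ.* p) * e    ≈⟨ *-congʳ (trans (φ-* (s ℤ.* r) p) (*-congʳ (φ-* s r))) ⟩
        φ s * φ r * φ p * e      ≈⟨ xy∙z≈xz∙y (φ s * φ r) (φ p) e ⟩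
        φ s * φ r * e * φ p      ≈⟨ *-congʳ (*-assoc (φ s) (φ r) e) ⟩
        φ s * (φ r * e) * φ p    ∎

    affine : ∀ {m} → Vec ℤ m × ℤ → Vector Carrier m → Carrier
    affine (u , e) v = ∑ (λ l → φ (Vec.lookup u l) * v l) + φ e

    affine≈combine : ∀ {m} r (v : Vector Carrier m) →
                     combine (coefficients r) (1# Vector.∷ v) ≈ affine r v
    affine≈combine (u , e) v = trans (+-congʳ (*-identityʳ (φ e))) (+-comm (φ e) _)

    -- Serves two purposes: `p` holds the binomial coefficients in the h*-expansion of f(k), and one
    -- coordinate of all points in the convex combination.
    sum-affine : ∀ {m n} (a : Carrier) (s : Vector ℤ n) (r : Fin n → Vec ℤ m × ℤ) (p : Vector ℤ n) (β : Vector ℤ (suc m)) →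
      (∀ l → β l ≡ sumℤ λ i → s i ℤ.* coefficients (r i) l ℤ.* p i) →
      ∀ v → a * combine β (1# Vector.∷ v) ≈ ∑ λ i → a * (φ (s i) * affine (r i) v) * φ (p i)
    sum-affine {m} {n} a s r p β β≡ v = begin
      a * combine β (1# Vector.∷ v)
        ≈⟨ *-congˡ (sum-combine s (coefficients ∘ r) p β β≡ (1# Vector.∷ v)) ⟩
      a * ∑ (λ i → φ (s i) * combine (coefficients (r i)) (1# Vector.∷ v) * φ (p i))
        ≈⟨ *-distribˡ-sum {n} a _ ⟩
      ∑ (λ i → a * (φ (s i) * combine (coefficients (r i)) (1# Vector.∷ v) * φ (p i)))
        ≈⟨ sum-cong-≋ {n} (λ i → trans (sym (*-assoc a _ _)) (*-congʳ (*-congˡ (*-congˡ (affine≈combine (r i) v))))) ⟩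
      ∑ (λ i → a * (φ (s i) * affine (r i) v) * φ (p i))
        ∎

    -- Vieta's formula in y = k² + k, with the integer `β`, the value of b(k)/a, absorbed into the
    -- coefficients.
    clProduct : ∀ (a b : Carrier) (β k : ℤ) → b ≈ a * φ β → ∀ {m} (c : Vector Carrier m) →
      b * ∏ (λ i → φ k * φ k + φ k + c i) ≈
      a * combine (λ l → β ℤ.* (k ℤ.* k ℤ.+ k) ℤ.^ (m ∸ toℕ l))
            (1# Vector.∷ λ (j : Fin m) → esym (suc (toℕ j)) (Vector.toList c))
    clProduct a b β k b≈ {m} c = begin
      b * ∏ (λ i → y + c i)
        ≈⟨ *-cong b≈ (vieta y c) ⟩
      a * φ β * evaluate y m e
        ≈⟨ *-assoc a (φ β) _ ⟩
      a * (φ β * evaluate y m e)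
        ≈⟨ *-congˡ (*-distribˡ-sum {suc m} (φ β) λ l → e (toℕ l) * y ^ (m ∸ toℕ l)) ⟩
      a * ∑ (λ (l : Fin (suc m)) → φ β * (e (toℕ l) * y ^ (m ∸ toℕ l)))
        ≈⟨ *-congˡ (sum-cong-≋ {suc m} term) ⟩
      a * combine (λ l → β ℤ.* (k ℤ.* k ℤ.+ k) ℤ.^ (m ∸ toℕ l)) E
        ∎
      where
      y = φ k * φ k + φ k
      e : ℕ → Carrier
      e l = esym l (Vector.toList c)
      E : Vector Carrier (suc m)
      E = 1# Vector.∷ λ j → e (suc (toℕ j))
      power : ∀ n → φ (β ℤ.* (k ℤ.* k ℤ.+ k) ℤ.^ n) ≈ φ β * y ^ n
      power n = trans (φ-* β _) (*-congˡ (trans (φ-^ _ n) (^-congˡ n (trans (φ-+ _ k) (+-congʳ (φ-* k k))))))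
      e≈ : ∀ (l : Fin (suc m)) → e (toℕ l) ≈ E l
      e≈ zero    = +-identityʳ 1#
      e≈ (suc l) = refl
      term : ∀ (l : Fin (suc m)) → φ β * (e (toℕ l) * y ^ (m ∸ toℕ l)) ≈
             φ (β ℤ.* (k ℤ.* k ℤ.+ k) ℤ.^ (m ∸ toℕ l)) * E l
      term l = begin
        φ β * (e (toℕ l) * y ^ (m ∸ toℕ l))  ≈⟨ *-congˡ (*-comm _ _) ⟩
        φ β * (y ^ (m ∸ toℕ l) * e (toℕ l))  ≈⟨ *-assoc _ _ _ ⟨
        φ β * y ^ (m ∸ toℕ l) * e (toℕ l)    ≈⟨ *-cong (sym (power (m ∸ toℕ l))) (e≈ l) ⟩
        φ (β ℤ.* (k ℤ.* k ℤ.+ k) ℤ.^ (m ∸ toℕ l)) * E l ∎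

    combine-δ : ∀ {n} D j (E : Vector Carrier n) → combine (λ l → D ℤ.* δ j l) E ≈ φ D * E j
    combine-δ {n} D j E = trans (sum-single (λ l → φ (D ℤ.* δ j l) * E l) j off-diagonal) diagonal
      where
      off-diagonal : ∀ l → j ≡.≢ l → φ (D ℤ.* δ j l) * E l ≈ 0#
      off-diagonal l j≢l with j Fin.≟ l
      ... | yes j≡l = contradiction j≡l j≢l
      ... | no  _   = trans (*-congʳ (trans (φ-* D 0ℤ) (trans (*-congˡ φ-0) (zeroʳ (φ D))))) (zeroˡ (E l))
      diagonal : φ (D ℤ.* δ j j) * E j ≈ φ D * E j
      diagonal with j Fin.≟ j
      ... | yes _   = *-congʳ (trans (φ-* D 1ℤ) (trans (*-congˡ φ-1) (*-identityʳ (φ D))))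
      ... | no  j≢j = contradiction ≡.refl j≢j

    -- The hypothesis on `D` and `δ` says that the matrix of the points, each extended by a leading
    -- 1, times the matrix of the scaled inequalities is `D` times the identity. Coordinate 0 then
    -- gives the total weight 1, and the others recover `v`.
    barycentric : ∀ {m n} (ρ : Carrier) (D : ℤ) → ρ * φ D ≈ 1# →
      ∀ (s : Vector ℤ n) (r : Fin n → Vec ℤ m × ℤ) (p : Fin n → Vec ℤ m) →
      (∀ j l → D ℤ.* δ j l ≡ sumℤ λ i → s i ℤ.* coefficients (r i) l ℤ.* Vec.lookup (1ℤ ∷ p i) j) →
      ∀ v → (∑ (λ i → ρ * (φ (s i) * affine (r i) v)) ≈ 1#) ×
            (∀ j → v j ≈ ∑ λ i → ρ * (φ (s i) * affine (r i) v) * φ (Vec.lookup (p i) j))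
    barycentric {m} {n} ρ D ρD≈1 s r p dual v = total , λ j → sym (coordinate (suc j))
      where
      w : Vector Carrier n
      w i = ρ * (φ (s i) * affine (r i) v)
      coordinate : ∀ j → ∑ (λ i → w i * φ (Vec.lookup (1ℤ ∷ p i) j)) ≈ (1# Vector.∷ v) j
      coordinate j = begin
        ∑ (λ i → w i * φ (Vec.lookup (1ℤ ∷ p i) j))
          ≈⟨ sum-affine ρ s r (λ i → Vec.lookup (1ℤ ∷ p i) j) (λ l → D ℤ.* δ j l) (dual j) v ⟨
        ρ * combine (λ l → D ℤ.* δ j l) (1# Vector.∷ v)
          ≈⟨ *-congˡ (combine-δ D j (1# Vector.∷ v)) ⟩
        ρ * (φ D * (1# Vector.∷ v) j)
          ≈⟨ *-assoc ρ (φ D) _ ⟨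
        ρ * φ D * (1# Vector.∷ v) j
          ≈⟨ trans (*-congʳ ρD≈1) (*-identityˡ _) ⟩
        (1# Vector.∷ v) j
          ∎
      total : ∑ w ≈ 1#
      total = trans (sum-cong-≋ {n} λ i → sym (trans (*-congˡ φ-1) (*-identityʳ (w i)))) (coordinate zero)

-- Order on the reals

open ℚ-Estimates
open ≈ℝ-Properties using (pointwise; ≈-sym; ≈-trans)

p≤∣p∣ : ∀ p → p ℚ.≤ ℚ.∣ p ∣
p≤∣p∣ p with ℚ.≤-total 0ℚ p
... | inj₁ 0≤p = ℚ.≤-reflexive (≡.sym (ℚ.0≤p⇒∣p∣≡p 0≤p))
... | inj₂ p≤0 = ℚ.≤-trans p≤0 (ℚ.0≤∣p∣ p)

-p≤∣p∣ : ∀ p → ℚ.- p ℚ.≤ ℚ.∣ p ∣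
-p≤∣p∣ p = ≡.subst (ℚ.- p ℚ.≤_) (ℚ.∣-p∣≡∣p∣ p) (p≤∣p∣ (ℚ.- p))

Eventually : (ℕ → Set) → Set
Eventually P = ∃ λ N → ∀ n → N ℕ.≤ n → P n

eventually₂ : ∀ {P Q S : ℕ → Set} → (∀ n → P n → Q n → S n) →
              Eventually P → Eventually Q → Eventually S
eventually₂ f (M , p) (N , q) = M ℕ.⊔ N , λ n n≥ → f n (p n (≤⊔₁ N n≥)) (q n (≤⊔₂ M n≥))

≤-resp-≈ : ∀ {x y} → x ≈ℝ y → 0ℝ ≤ℝ x → 0ℝ ≤ℝ y
≤-resp-≈ {x} {y} x≈y 0≤x ε ε>0 =
  eventually₂ bound (x≈y (ε ℚ.* ½) (half-pos ε>0)) (0≤x (ε ℚ.* ½) (half-pos ε>0))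
  where
  open ℚ.≤-Reasoning
  open +-*-Solver
  bound : ∀ n → ℚ.∣ seq x n ℚ.- seq y n ∣ ℚ.< ε ℚ.* ½ → 0ℚ ℚ.< seq x n ℚ.+ ε ℚ.* ½ →
          0ℚ ℚ.< seq y n ℚ.+ ε
  bound n close pos = begin-strict
    0ℚ
      <⟨ pos ⟩
    seq x n ℚ.+ ε ℚ.* ½
      ≡⟨ solve 3 (λ x y e → x :+ e := y :+ ((x :- y) :+ e)) ≡.refl (seq x n) (seq y n) (ε ℚ.* ½) ⟩
    seq y n ℚ.+ ((seq x n ℚ.- seq y n) ℚ.+ ε ℚ.* ½)
      ≤⟨ ℚ.+-monoʳ-≤ (seq y n) (ℚ.+-monoˡ-≤ (ε ℚ.* ½) (ℚ.≤-trans (p≤∣p∣ _) (ℚ.<⇒≤ close))) ⟩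
    seq y n ℚ.+ (ε ℚ.* ½ ℚ.+ ε ℚ.* ½)
      ≡⟨ ≡.cong (seq y n ℚ.+_) (half+half ε) ⟩
    seq y n ℚ.+ ε
      ∎

+-nonNeg : ∀ {x y} → 0ℝ ≤ℝ x → 0ℝ ≤ℝ y → 0ℝ ≤ℝ x +ℝ y
+-nonNeg {x} {y} 0≤x 0≤y ε ε>0 =
  eventually₂ bound (0≤x (ε ℚ.* ½) (half-pos ε>0)) (0≤y (ε ℚ.* ½) (half-pos ε>0))
  where
  open ℚ.≤-Reasoning
  open +-*-Solver
  bound : ∀ n → 0ℚ ℚ.< seq x n ℚ.+ ε ℚ.* ½ → 0ℚ ℚ.< seq y n ℚ.+ ε ℚ.* ½ →
          0ℚ ℚ.< (seq x n ℚ.+ seq y n) ℚ.+ ε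
  bound n x> y> = begin-strict
    0ℚ
      <⟨ ℚ.+-mono-< x> y> ⟩
    (seq x n ℚ.+ ε ℚ.* ½) ℚ.+ (seq y n ℚ.+ ε ℚ.* ½)
      ≡⟨ solve 3 (λ x y e → (x :+ e) :+ (y :+ e) := (x :+ y) :+ (e :+ e)) ≡.refl (seq x n) (seq y n) (ε ℚ.* ½) ⟩
    (seq x n ℚ.+ seq y n) ℚ.+ (ε ℚ.* ½ ℚ.+ ε ℚ.* ½)
      ≡⟨ ≡.cong ((seq x n ℚ.+ seq y n) ℚ.+_) (half+half ε) ⟩
    (seq x n ℚ.+ seq y n) ℚ.+ ε
      ∎

0≤0 : 0ℝ ≤ℝ 0ℝ
0≤0 ε ε>0 = 0 , λ _ _ → ≡.subst (0ℚ ℚ.<_) (≡.sym (ℚ.+-identityˡ ε)) ε>0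

sum-nonNeg : ∀ {n} (t : Vector ℝ n) → NonNegative t → 0ℝ ≤ℝ sum t
sum-nonNeg {zero}  t 0≤t = 0≤0
sum-nonNeg {suc n} t 0≤t =
  +-nonNeg {t zero} {sum (Vector.tail t)} (0≤t zero) (sum-nonNeg (Vector.tail t) λ i → 0≤t (suc i))

-- A term of `y` can be negative, but eventually by less than any given `δ`; since `x` is bounded,
-- `shrink` chooses `δ` so that the product stays above -ε. The factors used as `x` are non-negative
-- constants and a positive `a`, whose terms are eventually non-negative.
*-nonNeg : ∀ {x y} → Eventually (λ n → 0ℚ ℚ.≤ seq x n) → 0ℝ ≤ℝ y → 0ℝ ≤ℝ x *ℝ y
*-nonNeg {x} {y} 0≤x 0≤y ε ε>0 =
  let A , A>0 , x≤A = bounded (cauchy x)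
      δ , δ>0 , small = shrink A ε A>0 ε>0
  in eventually₂ (λ n (0≤xₙ , xₙ≤A) yₙ> → bound δ small n 0≤xₙ xₙ≤A yₙ>)
       (eventually₂ (λ _ → _,_) 0≤x x≤A) (0≤y δ δ>0)
  where
  open ℚ.≤-Reasoning
  bound : ∀ {A} δ → (∀ {p q} → ℚ.∣ p ∣ ℚ.≤ A → ℚ.∣ q ∣ ℚ.< δ → ℚ.∣ p ℚ.* q ∣ ℚ.< ε) →
          ∀ n → 0ℚ ℚ.≤ seq x n → ℚ.∣ seq x n ∣ ℚ.≤ A → 0ℚ ℚ.< seq y n ℚ.+ δ →
          0ℚ ℚ.< seq x n ℚ.* seq y n ℚ.+ ε
  bound δ small n 0≤x x≤A 0<y+δ with ℚ.≤-total 0ℚ (seq y n)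
  ... | inj₁ 0≤y = ℚ.+-mono-≤-<
        (ℚ.nonNegative⁻¹ (seq x n ℚ.* seq y n) {{ℚ.nonNeg*nonNeg⇒nonNeg (seq x n) {{ℚ.nonNegative 0≤x}} (seq y n) {{ℚ.nonNegative 0≤y}}}}) ε>0
  ... | inj₂ y≤0 = begin-strict
      0ℚ                                        ≡⟨ ℚ.+-inverseʳ (seq x n ℚ.* seq y n) ⟨
      seq x n ℚ.* seq y n ℚ.- seq x n ℚ.* seq y n <⟨ ℚ.+-monoʳ-< (seq x n ℚ.* seq y n) (ℚ.≤-<-trans (-p≤∣p∣ _) (small x≤A ∣y∣<δ)) ⟩
      seq x n ℚ.* seq y n ℚ.+ ε                 ∎
    where
    ∣y∣<δ : ℚ.∣ seq y n ∣ ℚ.< δ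
    ∣y∣<δ = begin-strict
      ℚ.∣ seq y n ∣      ≡⟨ ℚ.∣-p∣≡∣p∣ (seq y n) ⟨
      ℚ.∣ ℚ.- seq y n ∣  ≡⟨ ℚ.0≤p⇒∣p∣≡p (ℚ.neg-antimono-≤ y≤0) ⟩
      ℚ.- seq y n        ≡⟨ ℚ.+-identityʳ (ℚ.- seq y n) ⟨
      ℚ.- seq y n ℚ.+ 0ℚ <⟨ ℚ.+-monoʳ-< (ℚ.- seq y n) 0<y+δ ⟩
      ℚ.- seq y n ℚ.+ (seq y n ℚ.+ δ) ≡⟨ solve 2 (λ y d → :- y :+ (y :+ d) := d) ≡.refl (seq y n) δ ⟩
      δ                  ∎
      where open +-*-Solver

positive⇒nonNeg : ∀ {x} → 0ℝ <ℝ x → Eventually (λ n → 0ℚ ℚ.≤ seq x n)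
positive⇒nonNeg {x} (ε , ε>0 , N , x>) = N , λ n n≥ →
  ℚ.≤-trans (ℚ.<⇒≤ (≡.subst (0ℚ ℚ.<_) (≡.sym (ℚ.+-identityˡ ε)) ε>0)) (ℚ.<⇒≤ (x> n n≥))

*-positive : ∀ {x y} → 0ℝ <ℝ x → 0ℝ <ℝ y → 0ℝ <ℝ x *ℝ y
*-positive {x} {y} (ε , ε>0 , x>) (δ , δ>0 , y>) =
  ε ℚ.* δ , ℚ.positive⁻¹ _ {{ℚ.pos*pos⇒pos ε δ}} , eventually₂ bound x> y>
  where
  open ℚ.≤-Reasoning
  instance
    ε-pos : ℚ.Positive ε
    ε-pos = ℚ.positive ε>0
    δ-pos : ℚ.Positive δ
    δ-pos = ℚ.positive δ>0
  bound : ∀ n → 0ℚ ℚ.+ ε ℚ.< seq x n → 0ℚ ℚ.+ δ ℚ.< seq y n → 0ℚ ℚ.+ ε ℚ.* δ ℚ.< seq x n ℚ.* seq y n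
  bound n x> y> = begin-strict
    0ℚ ℚ.+ ε ℚ.* δ       ≡⟨ ℚ.+-identityˡ _ ⟩
    ε ℚ.* δ              <⟨ ℚ.*-monoʳ-<-pos ε (≡.subst (ℚ._< seq y n) (ℚ.+-identityˡ δ) y>) ⟩
    ε ℚ.* seq y n        <⟨ ℚ.*-monoˡ-<-pos (seq y n) {{ℚ.positive (ℚ.<-trans δ>0 (≡.subst (ℚ._< seq y n) (ℚ.+-identityˡ δ) y>))}} (≡.subst (ℚ._< seq x n) (ℚ.+-identityˡ ε) x>) ⟩
    seq x n ℚ.* seq y n  ∎

1-positive : 0ℝ <ℝ 1ℝ
1-positive = ½ , ℚ.positive⁻¹ ½ , 0 , λ _ _ → ℚ.*<* (ℤ.+<+ (ℕ.s≤s (ℕ.s≤s ℕ.z≤n)))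

product-positive : ∀ {n} (t : Vector ℝ n) → (∀ i → 0ℝ <ℝ t i) → 0ℝ <ℝ product t
product-positive {zero}  t 0<t = 1-positive
product-positive {suc n} t 0<t =
  *-positive {t zero} {product (Vector.tail t)} (0<t zero) (product-positive (Vector.tail t) λ i → 0<t (suc i))

-- With δ < x, the tolerance δ ε for the product suffices: x (y + ε) exceeds x y + δ ε, which is
-- positive.
*-cancel-nonNeg : ∀ {x y} → 0ℝ <ℝ x → 0ℝ ≤ℝ x *ℝ y → 0ℝ ≤ℝ y
*-cancel-nonNeg {x} {y} (δ , δ>0 , x>) 0≤xy ε ε>0 =
  eventually₂ bound x> (0≤xy (δ ℚ.* ε) (ℚ.positive⁻¹ _ {{ℚ.pos*pos⇒pos δ ε}}))
  where
  open ℚ.≤-Reasoning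
  instance
    ε-pos : ℚ.Positive ε
    ε-pos = ℚ.positive ε>0
    δ-pos : ℚ.Positive δ
    δ-pos = ℚ.positive δ>0
  bound : ∀ n → 0ℚ ℚ.+ δ ℚ.< seq x n → 0ℚ ℚ.< seq x n ℚ.* seq y n ℚ.+ δ ℚ.* ε → 0ℚ ℚ.< seq y n ℚ.+ ε
  bound n x> xy> = ℚ.*-cancelˡ-<-nonNeg (seq x n) {{ℚ.pos⇒nonNeg (seq x n) {{ℚ.positive (ℚ.<-trans δ>0 δ<x)}}}} (begin-strict
    seq x n ℚ.* 0ℚ                        ≡⟨ ℚ.*-zeroʳ (seq x n) ⟩
    0ℚ                                    <⟨ xy> ⟩
    seq x n ℚ.* seq y n ℚ.+ δ ℚ.* ε       <⟨ ℚ.+-monoʳ-< (seq x n ℚ.* seq y n) (ℚ.*-monoˡ-<-pos ε δ<x) ⟩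
    seq x n ℚ.* seq y n ℚ.+ seq x n ℚ.* ε ≡⟨ ℚ.*-distribˡ-+ (seq x n) (seq y n) ε ⟨
    seq x n ℚ.* (seq y n ℚ.+ ε)           ∎)
    where
    δ<x : δ ℚ.< seq x n
    δ<x = ≡.subst (ℚ._< seq x n) (ℚ.+-identityˡ δ) x>

≤-antisym : ∀ {x} → 0ℝ ≤ℝ x → 0ℝ ≤ℝ -ℝ x → x ≈ℝ 0ℝ
≤-antisym {x} 0≤x 0≤-x ε ε>0 = eventually₂ bound (0≤x ε ε>0) (0≤-x ε ε>0)
  where
  open ℚ.≤-Reasoning
  open +-*-Solver
  bound : ∀ n → 0ℚ ℚ.< seq x n ℚ.+ ε → 0ℚ ℚ.< ℚ.- seq x n ℚ.+ ε → ℚ.∣ seq x n ℚ.- 0ℚ ∣ ℚ.< ε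
  bound n x> -x> with ℚ.∣p∣≡p∨∣p∣≡-p (seq x n ℚ.- 0ℚ)
  ... | inj₁ eq = begin-strict
    ℚ.∣ seq x n ℚ.- 0ℚ ∣                ≡⟨ eq ⟩
    seq x n ℚ.- 0ℚ                      <⟨ ℚ.+-monoʳ-< (seq x n) -x> ⟩
    seq x n ℚ.+ (ℚ.- seq x n ℚ.+ ε)     ≡⟨ solve 2 (λ x e → x :+ (:- x :+ e) := e) ≡.refl (seq x n) ε ⟩
    ε                                   ∎
  ... | inj₂ eq = begin-strict
    ℚ.∣ seq x n ℚ.- 0ℚ ∣                ≡⟨ eq ⟩
    ℚ.- (seq x n ℚ.- 0ℚ)                ≡⟨ ≡.cong ℚ.-_ (ℚ.+-identityʳ (seq x n)) ⟩
    ℚ.- seq x n                         ≡⟨ ℚ.+-identityʳ (ℚ.- seq x n) ⟨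
    ℚ.- seq x n ℚ.+ 0ℚ                  <⟨ ℚ.+-monoʳ-< (ℚ.- seq x n) x> ⟩
    ℚ.- seq x n ℚ.+ (seq x n ℚ.+ ε)     ≡⟨ solve 2 (λ x e → :- x :+ (x :+ e) := e) ≡.refl (seq x n) ε ⟩
    ε                                   ∎

-- The order on ℝ is not decided here. For each tolerance ε it is enough to compare one rational
-- term, far out in the Cauchy sequence, with a fixed rational.
≮⇒≥ : ∀ {x} → ¬ (0ℝ <ℝ -ℝ x) → 0ℝ ≤ℝ x
≮⇒≥ {x} x≮0 ε ε>0 = decide (cauchy x η η>0)
  where
  open ℚ.≤-Reasoning
  open +-*-Solver
  -- A quarter of ε: if the chosen term is at most -2η, all later terms stay below -η; otherwise
  -- they stay above -3η, hence above -ε.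
  η = ε ℚ.* ½ ℚ.* ½
  η>0 : 0ℚ ℚ.< η
  η>0 = half-pos (half-pos ε>0)
  below : ∀ p q → p ℚ.≤ ℚ.- (η ℚ.+ η) → ℚ.∣ q ℚ.- p ∣ ℚ.< η → 0ℚ ℚ.+ η ℚ.< ℚ.- q
  below p q p≤ close = begin-strict
    0ℚ ℚ.+ η                          ≡⟨ solve 1 (λ e → con 0ℚ :+ e := :- (:- (e :+ e)) :- e) ≡.refl η ⟩
    ℚ.- (ℚ.- (η ℚ.+ η)) ℚ.- η         ≤⟨ ℚ.+-monoˡ-≤ (ℚ.- η) (ℚ.neg-antimono-≤ p≤) ⟩
    ℚ.- p ℚ.- η                       <⟨ ℚ.+-monoʳ-< (ℚ.- p) (ℚ.neg-antimono-< (ℚ.≤-<-trans (p≤∣p∣ (q ℚ.- p)) close)) ⟩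
    ℚ.- p ℚ.- (q ℚ.- p)               ≡⟨ solve 2 (λ p q → :- p :- (q :- p) := :- q) ≡.refl p q ⟩
    ℚ.- q                             ∎
  above : ∀ p q → ℚ.- (η ℚ.+ η) ℚ.< p → ℚ.∣ q ℚ.- p ∣ ℚ.< η → 0ℚ ℚ.< q ℚ.+ ε
  above p q p> close = begin-strict
    0ℚ                                          <⟨ η>0 ⟩
    η                                           ≡⟨ solve 1 (λ e → e := :- (e :+ e) :+ (e :+ (e :+ e))) ≡.refl η ⟩
    ℚ.- (η ℚ.+ η) ℚ.+ (η ℚ.+ (η ℚ.+ η))         <⟨ ℚ.+-monoˡ-< (η ℚ.+ (η ℚ.+ η)) p> ⟩
    p ℚ.+ (η ℚ.+ (η ℚ.+ η))                     ≡⟨ solve 3 (λ p q e → p :+ (e :+ (e :+ e)) := :- (q :- p) :+ (q :+ (e :+ (e :+ e)))) ≡.refl p q η ⟩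
    ℚ.- (q ℚ.- p) ℚ.+ (q ℚ.+ (η ℚ.+ (η ℚ.+ η))) <⟨ ℚ.+-monoˡ-< (q ℚ.+ (η ℚ.+ (η ℚ.+ η))) (ℚ.≤-<-trans (-p≤∣p∣ (q ℚ.- p)) close) ⟩
    η ℚ.+ (q ℚ.+ (η ℚ.+ (η ℚ.+ η)))             ≡⟨ solve 2 (λ q e → e :+ (q :+ (e :+ (e :+ e))) := q :+ ((e :+ e) :+ (e :+ e))) ≡.refl q η ⟩
    q ℚ.+ ((η ℚ.+ η) ℚ.+ (η ℚ.+ η))             ≡⟨ ≡.cong (λ e → q ℚ.+ (e ℚ.+ e)) (half+half (ε ℚ.* ½)) ⟩
    q ℚ.+ (ε ℚ.* ½ ℚ.+ ε ℚ.* ½)                 ≡⟨ ≡.cong (q ℚ.+_) (half+half ε) ⟩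
    q ℚ.+ ε                                     ∎
  decide : (∃ λ N → ∀ m n → N ℕ.≤ m → N ℕ.≤ n → ℚ.∣ seq x m ℚ.- seq x n ∣ ℚ.< η) →
           Eventually (λ n → 0ℚ ℚ.< seq x n ℚ.+ ε)
  decide (N , close) with seq x N ℚ.≤? ℚ.- (η ℚ.+ η)
  ... | yes xN≤ = contradiction
          (η , η>0 , N , λ n n≥ → below (seq x N) (seq x n) xN≤ (close n N n≥ ℕ.≤-refl)) x≮0
  ... | no  xN≰ = N , λ n n≥ → above (seq x N) (seq x n) (ℚ.≰⇒> xN≰) (close n N n≥ ℕ.≤-refl)

-- No positive lower bound for a is at hand; instead 0 ≤ x is stable under double negation.
*-cancel-nonNeg-≉0 : ∀ {a x} → 0ℝ ≤ℝ a → ¬ (a ≈ℝ 0ℝ) → 0ℝ ≤ℝ a *ℝ x → 0ℝ ≤ℝ x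
*-cancel-nonNeg-≉0 {a} {x} 0≤a a≉0 0≤ax = ≮⇒≥ {x} λ x<0 →
  a≉0 (≤-antisym {a} 0≤a (*-cancel-nonNeg { -ℝ x} { -ℝ a} x<0
    (≤-resp-≈ {a *ℝ x} { -ℝ x *ℝ -ℝ a} (pointwise (a *ℝ x) (-ℝ x *ℝ -ℝ a) λ n →
      solve 2 (λ a x → a :* x := (:- x) :* (:- a)) ≡.refl (seq a n) (seq x n)) 0≤ax)))
  where open +-*-Solver

≥¼⇒positive : ∀ {x} → fromℚ (+ 1 ℚ./ 4) ≤ℝ x → 0ℝ <ℝ x
≥¼⇒positive {x} ¼≤x = ⅛ , ℚ.positive⁻¹ ⅛ , proj₁ eventual , λ n n≥ → bound n (proj₂ eventual n n≥)
  where
  -- Half of ¼: the tolerance ⅛ still leaves the lower bound ⅛.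
  ⅛ = + 1 ℚ./ 8
  eventual = ¼≤x ⅛ (ℚ.positive⁻¹ ⅛)
  bound : ∀ n → + 1 ℚ./ 4 ℚ.< seq x n ℚ.+ ⅛ → 0ℚ ℚ.+ ⅛ ℚ.< seq x n
  bound n ¼< = ≡.subst (0ℚ ℚ.+ ⅛ ℚ.<_)
    (solve 2 (λ x e → (x :+ e) :+ (:- e) := x) ≡.refl (seq x n) ⅛) (ℚ.+-monoˡ-< (ℚ.- ⅛) ¼<)
    where open +-*-Solver

-- Integers inside the rationals and the reals

-- Operations in ℚ reduce to lowest terms, so the comparison is made in ℚᵘ, where the denominators
-- remain 1.
/1-homo-+ : ∀ x y → (x ℤ.+ y) ℚ./ 1 ≡ x ℚ./ 1 ℚ.+ y ℚ./ 1
/1-homo-+ x y = ℚ.toℚᵘ-injective (begin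
  ℚ.toℚᵘ ((x ℤ.+ y) ℚ./ 1)                   ≈⟨ ℚ.toℚᵘ-fromℚᵘ (ℚᵘ.mkℚᵘ (x ℤ.+ y) 0) ⟩
  ℚᵘ.mkℚᵘ (x ℤ.+ y) 0                        ≈⟨ ℚᵘ.*≡* (≡.cong (ℤ._* 1ℤ) (≡.cong₂ ℤ._+_ (≡.sym (ℤ.*-identityʳ x)) (≡.sym (ℤ.*-identityʳ y)))) ⟩
  ℚᵘ.mkℚᵘ x 0 ℚᵘ.+ ℚᵘ.mkℚᵘ y 0               ≈⟨ ℚᵘ.+-cong (ℚ.toℚᵘ-fromℚᵘ (ℚᵘ.mkℚᵘ x 0)) (ℚ.toℚᵘ-fromℚᵘ (ℚᵘ.mkℚᵘ y 0)) ⟨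
  ℚ.toℚᵘ (x ℚ./ 1) ℚᵘ.+ ℚ.toℚᵘ (y ℚ./ 1)     ≈⟨ ℚ.toℚᵘ-homo-+ (x ℚ./ 1) (y ℚ./ 1) ⟨
  ℚ.toℚᵘ (x ℚ./ 1 ℚ.+ y ℚ./ 1)               ∎)
  where open import Relation.Binary.Reasoning.Setoid ℚᵘ.≃-setoid

/1-homo-* : ∀ x y → (x ℤ.* y) ℚ./ 1 ≡ (x ℚ./ 1) ℚ.* (y ℚ./ 1)
/1-homo-* x y = ℚ.toℚᵘ-injective (begin
  ℚ.toℚᵘ ((x ℤ.* y) ℚ./ 1)                   ≈⟨ ℚ.toℚᵘ-fromℚᵘ (ℚᵘ.mkℚᵘ (x ℤ.* y) 0) ⟩
  ℚᵘ.mkℚᵘ x 0 ℚᵘ.* ℚᵘ.mkℚᵘ y 0               ≈⟨ ℚᵘ.*-cong (ℚ.toℚᵘ-fromℚᵘ (ℚᵘ.mkℚᵘ x 0)) (ℚ.toℚᵘ-fromℚᵘ (ℚᵘ.mkℚᵘ y 0)) ⟨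
  ℚ.toℚᵘ (x ℚ./ 1) ℚᵘ.* ℚ.toℚᵘ (y ℚ./ 1)     ≈⟨ ℚ.toℚᵘ-homo-* (x ℚ./ 1) (y ℚ./ 1) ⟨
  ℚ.toℚᵘ ((x ℚ./ 1) ℚ.* (y ℚ./ 1))               ∎)
  where open import Relation.Binary.Reasoning.Setoid ℚᵘ.≃-setoid

n/1-nonNeg : ∀ n → 0ℚ ℚ.≤ + n ℚ./ 1
n/1-nonNeg n = ℚ.nonNegative⁻¹ (+ n ℚ./ 1) {{ℚ.normalize-nonNeg n 1}}

fromℕ-positive : ∀ n → 0 ℕ.< n → 0ℝ <ℝ fromℕ n
fromℕ-positive n n>0 = q ℚ.* ½ , half-pos q>0 , 0 , λ _ _ →
  ≡.subst₂ ℚ._<_ (≡.sym (ℚ.+-identityˡ _)) (ℚ.*-identityʳ q)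
    (ℚ.*-monoʳ-<-pos q {{ℚ.positive q>0}} (ℚ.*<* (ℤ.+<+ (ℕ.s≤s (ℕ.s≤s ℕ.z≤n)))))
  where
  q = + n ℚ./ 1
  q>0 : 0ℚ ℚ.< q
  q>0 = ℚ.positive⁻¹ q {{ℚ.normalize-pos n 1 {{_}} {{ℕ.>-nonZero n>0}}}}

*-cancelʳ-nonNeg : ∀ {x y} → 0ℝ <ℝ y → 0ℝ ≤ℝ x *ℝ y → 0ℝ ≤ℝ x
*-cancelʳ-nonNeg {x} {y} 0<y 0≤xy = *-cancel-nonNeg {y} {x} 0<y
  (≤-resp-≈ {x *ℝ y} {y *ℝ x} (pointwise (x *ℝ y) (y *ℝ x) λ n → ℚ.*-comm (seq x n) (seq y n)) 0≤xy)

*-fromℕ-nonNeg : ∀ {x} n → 0ℝ ≤ℝ x → 0ℝ ≤ℝ x *ℝ fromℕ n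
*-fromℕ-nonNeg {x} n 0≤x = ≤-resp-≈ {fromℕ n *ℝ x} {x *ℝ fromℕ n}
  (pointwise (fromℕ n *ℝ x) (x *ℝ fromℕ n) λ m → ℚ.*-comm _ (seq x m))
  (*-nonNeg {fromℕ n} {x} (0 , λ _ _ → n/1-nonNeg n) 0≤x)

-- Integer certificates

-- The first argument is the value beyond the end of the list.
nth : ∀ {A : Set} → A → List A → ℕ → A
nth x []       _       = x
nth x (y ∷ ys) zero    = y
nth x (y ∷ ys) (suc k) = nth x ys k

-- The h*-coefficients k and d - k of f are a · scale d k · (⟨u,v⟩ + e), where (u , e) is the
-- k-th inequality, counted from 0.
scales : ℕ → List ℕ
scales 4  = 1 ∷ 2 ∷ 2 ∷ []
scales 5  = 1 ∷ 3 ∷ 2 ∷ []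
scales 6  = 1 ∷ 2 ∷ 1 ∷ 4 ∷ []
scales 7  = 1 ∷ 1 ∷ 3 ∷ 1 ∷ []
scales 8  = 1 ∷ 2 ∷ 4 ∷ 2 ∷ 2 ∷ []
scales 9  = 1 ∷ 1 ∷ 10 ∷ 2 ∷ 2 ∷ []
scales 10 = 1 ∷ 2 ∷ 1 ∷ 8 ∷ 2 ∷ 4 ∷ []
scales 11 = 1 ∷ 3 ∷ 1 ∷ 15 ∷ 6 ∷ 6 ∷ []
scales 12 = 1 ∷ 2 ∷ 2 ∷ 2 ∷ 3 ∷ 12 ∷ 12 ∷ []
scales 13 = 1 ∷ 1 ∷ 6 ∷ 14 ∷ 5 ∷ 3 ∷ 12 ∷ []
scales 14 = 1 ∷ 2 ∷ 1 ∷ 4 ∷ 1 ∷ 2 ∷ 3 ∷ 24 ∷ []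
scales _  = []

scale : ℕ → ℕ → ℕ
scale d = nth 0 (scales d)

-- The default is the inequality 0 ≥ 0, so that `row-holds` covers every index.
row : ∀ d → ℕ → Vec ℤ ⌊ d /2⌋ × ℤ
row d = nth (Vec.replicate _ 0ℤ , 0ℤ) (inequalities d)

-- On `Fin (suc d)` this is min(i, d - i); coefficients indexed through it are palindromic by
-- construction.
foldIndex : ∀ {n} → Fin n → ℕ
foldIndex i = toℕ i ⊓ toℕ (Fin.opposite i)

leadingℤ : Parity → ℤ → ℤ
leadingℤ 0ℙ z = 1ℤ
leadingℤ 1ℙ z = + 2 ℤ.* z ℤ.+ 1ℤ

-- The value at `k` of (b(z)/a) (z² + z)^(⌊d/2⌋ - l), the polynomial that v_l multiplies in f/a.
basis : ∀ d → Fin (suc ⌊ d /2⌋) → ℕ → ℤ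
basis d l k = leadingℤ (parity d) (+ k) ℤ.* (+ k ℤ.* + k ℤ.+ + k) ℤ.^ (⌊ d /2⌋ ∸ toℕ l)

binomial : ∀ d → ℕ → Fin (suc d) → ℤ
binomial d k i = + ((k ℕ.+ (d ∸ toℕ i)) C d)

-- The i-th h*-coefficient of `basis d l`, read off as the coefficient of v_l in the scaled
-- inequality.
hStarCoefficient : ∀ d → Fin (suc ⌊ d /2⌋) → Fin (suc d) → ℤ
hStarCoefficient d l i = + scale d (foldIndex i) ℤ.* coefficients (row d (foldIndex i)) l

-- The number of h*-coefficients equal to the k-th one by palindromicity.
multiplicity : ℕ → ℕ → ℕ
multiplicity d k = if does (k ℕ.+ k ℕ.≟ d) then 1 else 2

leadingCoefficient : Parity → ℕ
leadingCoefficient 0ℙ = 1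
leadingCoefficient 1ℙ = 2

-- The sum of the h*-coefficients of f is d ! times its leading coefficient, i.e. a · volume d.
volume : ℕ → ℕ
volume d = leadingCoefficient (parity d) ℕ.* d !

volume-nonZero : ∀ d → ℕ.NonZero (volume d)
volume-nonZero d = ℕ.m*n≢0 (leadingCoefficient (parity d)) (d !) {{positive (parity d)}} {{d ℕ.!≢0}}
  where
  positive : ∀ p → ℕ.NonZero (leadingCoefficient p)
  positive 0ℙ = _
  positive 1ℙ = _

-- Collects what depends on the listed numbers, in decidable form. The first part yields the
-- h*-expansion, the second and third let each inequality be recovered from an h*-coefficient, and
-- the last is the duality required by `barycentric`.
Certificate : ℕ → Set
Certificate d =
  (∀ (l : Fin (suc ⌊ d /2⌋)) (k : Fin (suc d)) →
    basis d l (toℕ k) ≡ sumℤ λ i → hStarCoefficient d l i ℤ.* binomial d (toℕ k) i) ×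
  (∀ (j : Fin (length (inequalities d))) → ∃ λ (i : Fin (suc d)) → foldIndex i ≡ toℕ j) ×
  (∀ (i : Fin (suc d)) → 0 < scale d (foldIndex i)) ×
  (∀ (j l : Fin (suc ⌊ d /2⌋)) →
    + volume d ℤ.* δ j l ≡ sumℤ λ (i : Fin (length (vertices d))) →
      + (multiplicity d (toℕ i) ℕ.* scale d (toℕ i)) ℤ.* coefficients (row d (toℕ i)) l
        ℤ.* Vec.lookup (1ℤ ∷ List.lookup (vertices d) i) j)

certificate? : ∀ d → Dec (Certificate d)
certificate? d =
  Fin.all? (λ l → Fin.all? λ k → _ ℤ.≟ _) ×-dec
  Fin.all? (λ j → Fin.any? λ i → foldIndex i ℕ.≟ toℕ j) ×-dec
  Fin.all? (λ i → 0 ℕ.<? scale d (foldIndex i)) ×-dec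
  Fin.all? (λ j → Fin.all? λ l → _ ℤ.≟ _)

abstract
  -- Evaluation decides all degrees below 15 at once, those below 4 vacuously; `abstract` keeps the
  -- result from being unfolded in later proofs.
  certificate : ∀ {d} → d < 15 → 4 ≤ d → Certificate d
  certificate = toWitness {a? = ℕ.allUpTo? (λ d → 4 ℕ.≤? d →-dec certificate? d) 15} tt

-- Binomial expansion of the basis polynomials

leadingDegree : Parity → ℕ
leadingDegree 0ℙ = 0
leadingDegree 1ℙ = 1

degree-leading : ∀ p n {f} → DegreeBelow n f →
                 DegreeBelow (leadingDegree p ℕ.+ n) (λ k → leadingℤ p (+ k) ℤ.* f k)
degree-leading 0ℙ n {f} f-deg = degree-resp-≗ n (λ k → ≡.sym (ℤ.*-identityˡ (f k))) f-deg
degree-leading 1ℙ n {f} f-deg = degree-resp-≗ (suc n)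
  (λ k → expand (+ k) (f k))
  (degree-+ (suc n) {λ k → + 2 ℤ.* (+ k ℤ.* f k)} {f}
    (degree-scale (suc n) (+ 2) {λ k → + k ℤ.* f k} (degree-*k n {f} f-deg)) (degree-suc n {f} f-deg))
  where
  expand : ∀ k f → + 2 ℤ.* (k ℤ.* f) ℤ.+ f ≡ (+ 2 ℤ.* k ℤ.+ 1ℤ) ℤ.* f
  expand = ℤ-Solver.solve-∀

leadingDegree+2⌊d/2⌋≤d : ∀ d → leadingDegree (parity d) ℕ.+ (⌊ d /2⌋ ℕ.+ ⌊ d /2⌋) ≤ d
leadingDegree+2⌊d/2⌋≤d zero          = z≤n
leadingDegree+2⌊d/2⌋≤d (suc zero)    = s≤s z≤n
leadingDegree+2⌊d/2⌋≤d (suc (suc d)) = ≡.subst (_≤ suc (suc d)) (≡.sym shift) (s≤s (s≤s (leadingDegree+2⌊d/2⌋≤d d)))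
  where
  p = leadingDegree (parity d)
  m = ⌊ d /2⌋
  open ≡.≡-Reasoning
  shift : p ℕ.+ (suc m ℕ.+ suc m) ≡ suc (suc (p ℕ.+ (m ℕ.+ m)))
  shift = begin
    p ℕ.+ suc (m ℕ.+ suc m)      ≡⟨ ℕ.+-suc p (m ℕ.+ suc m) ⟩
    suc (p ℕ.+ (m ℕ.+ suc m))    ≡⟨ ≡.cong (λ n → suc (p ℕ.+ n)) (ℕ.+-suc m m) ⟩
    suc (p ℕ.+ suc (m ℕ.+ m))    ≡⟨ ≡.cong suc (ℕ.+-suc p (m ℕ.+ m)) ⟩
    suc (suc (p ℕ.+ (m ℕ.+ m)))  ∎

degree-basis : ∀ d l → DegreeBelow (suc d) (basis d l)
degree-basis d l = degree-mono {f = basis d l} bound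
  (degree-leading (parity d) (suc (e ℕ.+ e)) (degree-power e))
  where
  e = ⌊ d /2⌋ ∸ toℕ l
  p = leadingDegree (parity d)
  e≤ : e ≤ ⌊ d /2⌋
  e≤ = ℕ.m∸n≤m ⌊ d /2⌋ (toℕ l)
  bound : p ℕ.+ suc (e ℕ.+ e) ≤ suc d
  bound = ≡.subst (_≤ suc d) (≡.sym (ℕ.+-suc p (e ℕ.+ e)))
    (s≤s (ℕ.≤-trans (ℕ.+-monoʳ-≤ p (ℕ.+-mono-≤ e≤ e≤)) (leadingDegree+2⌊d/2⌋≤d d)))

-- Both sides have degree at most `d` in `k`, so the d + 1 values checked by the certificate
-- determine them.
basis-expansion : ∀ d →
  (∀ l (k : Fin (suc d)) → basis d l (toℕ k) ≡ sumℤ λ i → hStarCoefficient d l i ℤ.* binomial d (toℕ k) i) →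
  ∀ k l → basis d l k ≡ sumℤ λ i → hStarCoefficient d l i ℤ.* binomial d k i
basis-expansion d small k l = agree (suc d) {basis d l} {λ k → sumℤ λ i → hStarCoefficient d l i ℤ.* binomial d k i}
  (degree-basis d l)
  (degree-sum (suc d) {f = λ i k → hStarCoefficient d l i ℤ.* binomial d k i} λ i →
    degree-scale (suc d) (hStarCoefficient d l i) {λ k → binomial d k i} (degree-binomial d (d ∸ toℕ i)))
  (λ k k<1+d → ≡.subst (λ k → basis d l k ≡ sumℤ λ i → hStarCoefficient d l i ℤ.* binomial d k i)
    (Fin.toℕ-fromℕ< k<1+d) (small l (Fin.fromℕ< k<1+d)))
  k

-- CL-polynomials

module ℝ-Identities = RingIdentities ℝ-commutativeRing

open RingIdentities ℚ.+-*-commutativeRing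
open Integers (ℚ._/ 1) ≡.refl ≡.refl /1-homo-+ /1-homo-*

-- The polynomial identities between reals hold index by index, so they are proved in ℚ.
seq-sum : ∀ {m} (t : Vector ℝ m) n → seq (sum t) n ≡ sumℚ λ i → seq (t i) n
seq-sum {zero}  t n = ≡.refl
seq-sum {suc m} t n = ≡.cong (seq (t zero) n ℚ.+_) (seq-sum (λ i → t (suc i)) n)

seq-product : ∀ {m} (t : Vector ℝ m) n → seq (product t) n ≡ productℚ λ i → seq (t i) n
seq-product {zero}  t n = ≡.refl
seq-product {suc m} t n = ≡.cong (seq (t zero) n ℚ.*_) (seq-product (λ i → t (suc i)) n)

combinations-map : ∀ {A B : Set} (f : A → B) l xs →
  combinations l (List.map f xs) ≡ List.map (List.map f) (combinations l xs)
combinations-map f zero    xs       = ≡.refl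
combinations-map f (suc l) []       = ≡.refl
combinations-map f (suc l) (x ∷ xs) = begin
  List.map (f x ∷_) (combinations l (List.map f xs)) List.++ combinations (suc l) (List.map f xs)
    ≡⟨ ≡.cong₂ (λ yss zss → List.map (f x ∷_) yss List.++ zss) (combinations-map f l xs) (combinations-map f (suc l) xs) ⟩
  List.map (f x ∷_) (List.map (List.map f) (combinations l xs)) List.++ List.map (List.map f) (combinations (suc l) xs)
    ≡⟨ ≡.cong (List._++ _) (≡.trans (≡.sym (List.map-∘ (combinations l xs))) (List.map-∘ (combinations l xs))) ⟩
  List.map (List.map f) (List.map (x ∷_) (combinations l xs)) List.++ List.map (List.map f) (combinations (suc l) xs)
    ≡⟨ List.map-++ (List.map f) (List.map (x ∷_) (combinations l xs)) (combinations (suc l) xs) ⟨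
  List.map (List.map f) (combinations (suc l) (x ∷ xs))
    ∎
  where open ≡.≡-Reasoning

seq-elementarySymmetric : ∀ {m} l (c : Vector ℝ m) n →
  seq (elementarySymmetric l c) n ≡ esym l (Vector.toList λ i → seq (c i) n)
seq-elementarySymmetric l c n = ≡.trans (sums (combinations l (Vector.toList c)))
  (≡.cong sumOfProducts (≡.trans (≡.sym (combinations-map (λ x → seq x n) l (Vector.toList c)))
    (≡.cong (combinations l) (List.map-tabulate c λ x → seq x n))))
  where
  products : ∀ xs → seq (List.foldr _*ℝ_ 1ℝ xs) n ≡ List.foldr ℚ._*_ 1ℚ (List.map (λ x → seq x n) xs)
  products []       = ≡.refl
  products (x ∷ xs) = ≡.cong (seq x n ℚ.*_) (products xs)
  sums : ∀ xss → seq (List.foldr _+ℝ_ 0ℝ (List.map (List.foldr _*ℝ_ 1ℝ) xss)) n ≡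
         sumOfProducts (List.map (List.map λ x → seq x n) xss)
  sums []         = ≡.refl
  sums (xs ∷ xss) = ≡.cong₂ ℚ._+_ (products xs) (sums xss)

value : ∀ {m} → Vec ℤ m × ℤ → Vector ℝ m → ℝ
value (u , e) v = ⟨ fromℤⁿ u , v ⟩ +ℝ fromℤ e

seq-value : ∀ {m} r (v : Vector ℝ m) n → seq (value r v) n ≡ affine r (λ i → seq (v i) n)
seq-value (u , e) v n = ≡.cong (ℚ._+ e ℚ./ 1) (seq-sum (λ i → fromℤⁿ u i *ℝ v i) n)

seq-leadingFactor : ∀ p a k n → seq (leadingFactor p a (fromℤ k)) n ≡ seq a n ℚ.* (leadingℤ p k ℚ./ 1)
seq-leadingFactor 0ℙ a k n = ≡.sym (ℚ.*-identityʳ (seq a n))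
seq-leadingFactor 1ℙ a k n = ≡.cong (seq a n ℚ.*_)
  (≡.sym (≡.trans (/1-homo-+ (+ 2 ℤ.* k) 1ℤ) (≡.cong (ℚ._+ 1ℚ) (/1-homo-* (+ 2) k))))

hStar : ∀ d → ℝ → Vector ℝ ⌊ d /2⌋ → ℕ → ℝ
hStar d a v k = a *ℝ (fromℕ (scale d k) *ℝ value (row d k) v)

-- `clProduct` writes f(k) as a combination of the `basis` values, and `sum-affine` regroups their
-- h*-expansions by binomial coefficient.
isHStar : ∀ d → Certificate d → ∀ a c →
          IsHStar d (clPolynomial d a c) (λ i → hStar d a (symmetricVector c) (foldIndex i))
isHStar d (small , _) a c k = pointwise (clPolynomial d a c (fromℕ k)) (sum t) λ n → begin
  seq (leadingFactor (parity d) a (fromℕ k)) n ℚ.* seq (product factor) n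
    ≡⟨ ≡.cong (seq (leadingFactor (parity d) a (fromℕ k)) n ℚ.*_) (seq-product factor n) ⟩
  seq (leadingFactor (parity d) a (fromℕ k)) n ℚ.* productℚ (λ i → seq (factor i) n)
    ≡⟨ clProduct (seq a n) (seq (leadingFactor (parity d) a (fromℕ k)) n) (leadingℤ (parity d) (+ k)) (+ k)
         (seq-leadingFactor (parity d) a (+ k) n) (λ i → seq (c i) n) ⟩
  seq a n ℚ.* combine (λ l → basis d l k) (1ℚ Vector.∷ (e n))
    ≡⟨ sum-affine (seq a n) (λ i → + scale d (foldIndex i)) (λ i → row d (foldIndex i)) (binomial d k)
         (λ l → basis d l k) (basis-expansion d small k) (e n) ⟩
  sumℚ (λ i → seq a n ℚ.* ((+ scale d (foldIndex i) ℚ./ 1) ℚ.* affine (row d (foldIndex i)) (e n)) ℚ.* (binomial d k i ℚ./ 1))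
    ≡⟨ sum-cong-≗ {suc d} (λ i → ≡.cong (λ x → seq a n ℚ.* ((+ scale d (foldIndex i) ℚ./ 1) ℚ.* x) ℚ.* (binomial d k i ℚ./ 1))
         (≡.sym (≡.trans (seq-value (row d (foldIndex i)) (symmetricVector c) n) (affine-cong (row d (foldIndex i)) λ j → seq-elementarySymmetric (suc (toℕ j)) c n)))) ⟩
  sumℚ (λ i → seq (t i) n)
    ≡⟨ seq-sum t n ⟨
  seq (sum t) n
    ∎
  where
  open ≡.≡-Reasoning
  e : ℕ → Vector ℚ ⌊ d /2⌋
  e n j = esym (suc (toℕ j)) (Vector.toList λ i → seq (c i) n)
  factor : Vector ℝ ⌊ d /2⌋
  factor i = fromℕ k *ℝ fromℕ k +ℝ fromℕ k +ℝ c i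
  t : Vector ℝ (suc d)
  t i = hStar d a (symmetricVector c) (foldIndex i) *ℝ fromℕ ((k ℕ.+ (d ∸ toℕ i)) C d)
  affine-cong : ∀ {m} r {x y : Vector ℚ m} → (∀ j → x j ≡ y j) → affine r x ≡ affine r y
  affine-cong (u , e) x≗y = ≡.cong (ℚ._+ e ℚ./ 1) (sum-cong-≗ λ j → ≡.cong (Vec.lookup u j ℚ./ 1 ℚ.*_) (x≗y j))

-- Uniqueness of the h*-coefficients and the sign of the leading constant

-- For the values at 0, ..., d, the top entry k + (d - i) equals `d` on the diagonal and is smaller
-- for k < i, so the binomial matrix is unitriangular.
hStar-unique : ∀ d {f g h} → IsHStar d f g → IsHStar d f h → ∀ i → g i ≈ℝ h i
hStar-unique d {f} {g} {h} g-hStar h-hStar = ℝ-Identities.unitriangular-unique (λ k i → fromℕ ((toℕ k ℕ.+ (d ∸ toℕ i)) C d))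
  diagonal upper g h λ k → ≈-trans
    (sum λ i → g i *ℝ fromℕ ((toℕ k ℕ.+ (d ∸ toℕ i)) C d)) (f (fromℕ (toℕ k))) (sum λ i → h i *ℝ fromℕ ((toℕ k ℕ.+ (d ∸ toℕ i)) C d))
    (≈-sym (f (fromℕ (toℕ k))) (sum λ i → g i *ℝ fromℕ ((toℕ k ℕ.+ (d ∸ toℕ i)) C d)) (g-hStar (toℕ k))) (h-hStar (toℕ k))
  where
  diagonal : ∀ (k : Fin (suc d)) → fromℕ ((toℕ k ℕ.+ (d ∸ toℕ k)) C d) ≈ℝ 1ℝ
  diagonal k = pointwise (fromℕ ((toℕ k ℕ.+ (d ∸ toℕ k)) C d)) 1ℝ λ _ → ≡.cong (λ n → + n ℚ./ 1)
    (≡.trans (≡.cong (_C d) (ℕ.m+[n∸m]≡n (Fin.toℕ≤pred[n] k))) (nCn≡1 d))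
  upper : ∀ (k i : Fin (suc d)) → toℕ k < toℕ i → fromℕ ((toℕ k ℕ.+ (d ∸ toℕ i)) C d) ≈ℝ 0ℝ
  upper k i k<i = pointwise (fromℕ ((toℕ k ℕ.+ (d ∸ toℕ i)) C d)) 0ℝ λ _ → ≡.cong (λ n → + n ℚ./ 1)
    (k>n⇒nCk≡0 (≡.subst (toℕ k ℕ.+ (d ∸ toℕ i) <_) (ℕ.m+[n∸m]≡n (Fin.toℕ≤pred[n] i)) (ℕ.+-monoˡ-< (d ∸ toℕ i) k<i)))

leadingFactor-0 : ∀ p a → leadingFactor p a (fromℕ 0) ≈ℝ a
leadingFactor-0 0ℙ a = pointwise a a λ _ → ≡.refl
leadingFactor-0 1ℙ a = pointwise (leadingFactor 1ℙ a (fromℕ 0)) a λ n → ℚ.*-identityʳ (seq a n)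

-- The bound ¼ enters here: it makes the product of the `c i` positive, so that it can be cancelled
-- from f(0), a non-negative combination of the `h i`.
diamond⇒0≤a : ∀ d a c → (∀ i → fromℚ (+ 1 / 4) ≤ℝ c i) → Diamond d (clPolynomial d a c) → 0ℝ ≤ℝ a
diamond⇒0≤a d a c ¼≤c (h , h-hStar , _ , 0≤h) =
  ≤-resp-≈ {leadingFactor (parity d) a (fromℕ 0)} {a} (leadingFactor-0 (parity d) a)
    (*-cancelʳ-nonNeg {leadingFactor (parity d) a (fromℕ 0)} {product (λ i → fromℕ 0 *ℝ fromℕ 0 +ℝ fromℕ 0 +ℝ c i)}
      (product-positive (λ i → fromℕ 0 *ℝ fromℕ 0 +ℝ fromℕ 0 +ℝ c i) factor>0)
      (≤-resp-≈ {sum λ i → h i *ℝ fromℕ ((0 ℕ.+ (d ∸ toℕ i)) C d)} {clPolynomial d a c (fromℕ 0)}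
        (≈-sym (clPolynomial d a c (fromℕ 0)) (sum λ i → h i *ℝ fromℕ ((0 ℕ.+ (d ∸ toℕ i)) C d)) (h-hStar 0))
        (sum-nonNeg (λ i → h i *ℝ fromℕ ((0 ℕ.+ (d ∸ toℕ i)) C d)) λ i →
          *-fromℕ-nonNeg {h i} ((0 ℕ.+ (d ∸ toℕ i)) C d) (0≤h i))))
  where
  factor>0 : ∀ i → 0ℝ <ℝ fromℕ 0 *ℝ fromℕ 0 +ℝ fromℕ 0 +ℝ c i
  factor>0 i =
    let ε , ε>0 , N , cᵢ> = ≥¼⇒positive {c i} (¼≤c i)
    in ε , ε>0 , N , λ n n≥ → ≡.subst (0ℚ ℚ.+ ε ℚ.<_) (≡.sym (ℚ.+-identityˡ (seq (c i) n))) (cᵢ> n n≥)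

-- The two implications between the property and the inequalities

all-nth⁺ : ∀ {A : Set} {P : A → Set} {x xs} → P x → All P xs → ∀ k → P (nth x xs k)
all-nth⁺ px []         k       = px
all-nth⁺ px (py ∷ pys) zero    = py
all-nth⁺ px (py ∷ pys) (suc k) = all-nth⁺ px pys k

all-nth⁻ : ∀ {A : Set} {P : A → Set} x xs → (∀ (j : Fin (length xs)) → P (nth x xs (toℕ j))) → All P xs
all-nth⁻ x []       p = []
all-nth⁻ x (y ∷ ys) p = p zero ∷ all-nth⁻ x ys λ j → p (suc j)

all-row⁺ : ∀ d {P : Vec ℤ ⌊ d /2⌋ × ℤ → Set} → P (Vec.replicate _ 0ℤ , 0ℤ) →
           All P (inequalities d) → ∀ k → P (row d k)
all-row⁺ d {P} = all-nth⁺ {P = P}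

all-row⁻ : ∀ d {P : Vec ℤ ⌊ d /2⌋ × ℤ → Set} →
           (∀ (j : Fin (length (inequalities d))) → P (row d (toℕ j))) → All P (inequalities d)
all-row⁻ d {P} = all-nth⁻ {P = P} _ (inequalities d)

row-holds : ∀ d v → Inequalities d v → ∀ k → Holds v (row d k)
row-holds d v = all-row⁺ d {Holds v} trivial
  where
  trivial : Holds v (Vec.replicate _ 0ℤ , 0ℤ)
  trivial = +-nonNeg {⟨ fromℤⁿ (Vec.replicate _ 0ℤ) , v ⟩} {fromℤ 0ℤ}
    (sum-nonNeg (λ i → fromℤⁿ (Vec.replicate _ 0ℤ) i *ℝ v i) λ i →
      ≤-resp-≈ {0ℝ} {fromℤⁿ (Vec.replicate _ 0ℤ) i *ℝ v i}
        (pointwise 0ℝ (fromℤⁿ (Vec.replicate _ 0ℤ) i *ℝ v i) λ n →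
          ≡.trans (≡.sym (ℚ.*-zeroˡ (seq (v i) n))) (≡.cong (λ z → z ℚ./ 1 ℚ.* seq (v i) n) (≡.sym (lookup-replicate i 0ℤ))))
        0≤0)
    0≤0

-- By uniqueness `h i` is `a` times a positive integer times the left-hand side of an inequality,
-- and both factors can be cancelled.
diamond⇒inequalities : ∀ d → Certificate d → ∀ a → ¬ (a ≈ℝ 0ℝ) → ∀ c → (∀ i → fromℚ (+ 1 / 4) ≤ℝ c i) →
  Diamond d (clPolynomial d a c) → Inequalities d (symmetricVector c)
diamond⇒inequalities d cert@(_ , onto , scale>0 , _) a a≉0 c ¼≤c ◇@(h , h-hStar , _ , 0≤h) =
  all-row⁻ d {Holds (symmetricVector c)} λ j →
    let i , i≡j = onto j
    in ≡.subst (λ k → Holds (symmetricVector c) (row d k)) i≡j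
      (nonNeg⇒holds (foldIndex i) (symmetricVector c) (scale>0 i)
        (≤-resp-≈ {h i} {hStar d a (symmetricVector c) (foldIndex i)}
          (hStar-unique d {clPolynomial d a c} {h} {λ i → hStar d a (symmetricVector c) (foldIndex i)}
            h-hStar (isHStar d cert a c) i)
          (0≤h i)))
  where
  nonNeg⇒holds : ∀ k v → 0 < scale d k → 0ℝ ≤ℝ hStar d a v k → Holds v (row d k)
  nonNeg⇒holds k v s>0 0≤h =
    *-cancel-nonNeg {fromℕ (scale d k)} {value (row d k) v} (fromℕ-positive (scale d k) s>0)
      (*-cancel-nonNeg-≉0 {a} {fromℕ (scale d k) *ℝ value (row d k) v} (diamond⇒0≤a d a c ¼≤c ◇) a≉0 0≤h)

foldIndex-opposite : ∀ {n} (i : Fin n) → foldIndex i ≡ foldIndex (Fin.opposite i)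
foldIndex-opposite i = ≡.trans (ℕ.⊓-comm (toℕ i) _)
  (≡.cong (λ j → toℕ (Fin.opposite i) ⊓ toℕ j) (≡.sym (Fin.opposite-involutive i)))

-- Covers the h*-coefficients, with `x` equal to `a`, and the barycentric weights, with `x` the
-- inverse of `volume d`.
scaled-nonNeg : ∀ d v → Inequalities d v → ∀ x → Eventually (λ n → 0ℚ ℚ.≤ seq x n) →
                ∀ m k → 0ℝ ≤ℝ x *ℝ (fromℕ m *ℝ value (row d k) v)
scaled-nonNeg d v ineqs x 0≤x m k =
  *-nonNeg {x} {fromℕ m *ℝ value (row d k) v} 0≤x
    (*-nonNeg {fromℕ m} {value (row d k) v} (0 , λ _ _ → n/1-nonNeg m) (row-holds d v ineqs k))

inequalities⇒diamond : ∀ d → Certificate d → ∀ a c → 0ℝ <ℝ a →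
  Inequalities d (symmetricVector c) → Diamond d (clPolynomial d a c)
inequalities⇒diamond d cert a c 0<a ineqs =
  (λ i → hStar d a (symmetricVector c) (foldIndex i)) ,
  isHStar d cert a c ,
  (λ i → palindromic (symmetricVector c) (foldIndex-opposite i)) ,
  (λ i → scaled-nonNeg d (symmetricVector c) ineqs a (positive⇒nonNeg {a} 0<a) (scale d (foldIndex i)) (foldIndex i))
  where
  palindromic : ∀ v {k l} → k ≡ l → hStar d a v k ≈ℝ hStar d a v l
  palindromic v {k} ≡.refl = pointwise (hStar d a v k) (hStar d a v k) λ _ → ≡.refl

-- Barycentric coordinates

-- By duality, every inequality except the `i`-th is an equality at the `i`-th point. The suitably
-- scaled left-hand sides are therefore barycentric coordinates of any `v`, and the inequalities
-- make them non-negative.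
inequalities⇒hull : ∀ d → Certificate d → ∀ v → Inequalities d v → InConvexHull (vertices d) v
inequalities⇒hull d (_ , _ , _ , dual) v ineqs =
  w ,
  (λ i → scaled-nonNeg d v ineqs (fromℚ (ℚ.1/ q)) (0 , λ _ _ → 1/q-nonNeg) (t i) (toℕ i)) ,
  pointwise (sum w) 1ℝ (λ n →
    ≡.trans (seq-sum w n) (≡.trans (sum-cong-≗ (seq-w n)) (proj₁ (coordinates n)))) ,
  λ j → pointwise (v j) (sum λ i → w i *ℝ fromℤⁿ (List.lookup (vertices d) i) j) λ n →
    ≡.trans (proj₂ (coordinates n) j) (≡.sym (≡.trans (seq-sum (λ i → w i *ℝ fromℤⁿ (List.lookup (vertices d) i) j) n)
      (sum-cong-≗ λ i → ≡.cong (ℚ._* (Vec.lookup (List.lookup (vertices d) i) j ℚ./ 1)) (seq-w n i))))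
  where
  q = + volume d ℚ./ 1
  instance
    q-pos : ℚ.Positive q
    q-pos = ℚ.normalize-pos (volume d) 1 {{_}} {{volume-nonZero d}}
    q-nonZero : ℚ.NonZero q
    q-nonZero = ℚ.pos⇒nonZero q
  1/q-nonNeg : 0ℚ ℚ.≤ ℚ.1/ q
  1/q-nonNeg = ℚ.nonNegative⁻¹ (ℚ.1/ q) {{ℚ.pos⇒nonNeg (ℚ.1/ q) {{ℚ.1/pos⇒pos q}}}}
  t : Fin (length (vertices d)) → ℕ
  t i = multiplicity d (toℕ i) ℕ.* scale d (toℕ i)
  w : Vector ℝ (length (vertices d))
  -- For the `v` of a CL-polynomial this is the joint share of the h*-coefficients at `i` and d - i
  -- in the sum of all of them; the factor `a` cancels.
  w i = fromℚ (ℚ.1/ q) *ℝ (fromℕ (t i) *ℝ value (row d (toℕ i)) v)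
  coordinates : ∀ n → _
  coordinates n = barycentric (ℚ.1/ q) (+ volume d) (ℚ.*-inverseˡ q) (λ i → + t i) (λ i → row d (toℕ i))
    (List.lookup (vertices d)) dual (λ j → seq (v j) n)
  seq-w : ∀ n i → seq (w i) n ≡ ℚ.1/ q ℚ.* ((+ t i ℚ./ 1) ℚ.* affine (row d (toℕ i)) (λ j → seq (v j) n))
  seq-w n i = ≡.cong (λ x → ℚ.1/ q ℚ.* ((+ t i ℚ./ 1) ℚ.* x)) (seq-value (row d (toℕ i)) v n)

mainTheorem4 :
    (d : ℕ) → 4 ≤ d → d ≤ 14 →
    (a : ℝ) → ¬ (a ≈ℝ 0ℝ) →
    (c : Vector ℝ ⌊ d /2⌋) → (∀ i → fromℚ (+ 1 / 4) ≤ℝ c i) →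
    let f = clPolynomial d a c
        v = symmetricVector c
    in
    -- 0 < a is needed in this direction only: Diamond fails for every a < 0.
    (Diamond d f → Inequalities d v) ×
    (0ℝ <ℝ a → Inequalities d v → Diamond d f) ×
    (Inequalities d v → InConvexHull (vertices d) v)
mainTheorem4 d 4≤d d≤14 a a≉0 c ¼≤c =
  diamond⇒inequalities d cert a a≉0 c ¼≤c ,
  inequalities⇒diamond d cert a c ,
  inequalities⇒hull d cert (symmetricVector c)
  where
  cert : Certificate d
  cert = certificate (s≤s d≤14) 4≤d
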